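{- Let $(V,E,k,m)$ be an instance of VCHC on a multigraph $G=(V,E)$ whose relaxation LP1 is feasible. The output $(\bar x,\bar y)$ of the Iterative Rounding Algorithm using Simpler Covering LPs for Graphs (described in the context) is a $2$-approximation for VCHC: the integral vector $\bar x$ admits an integral assignment $y'$ such that $(\bar x,y')$ is a feasible solution to VCHC, and $\sum_{v\in V}\bar x_v\le 2\cdot\mathrm{OPT}$, where $\mathrm{OPT}$ is the minimum of $\sum_{v\in V}x_v$ over all feasible solutions $(x,y)$ to VCHC.
   Context: **Problem.** $G=(V,E)$ is a finite loopless multigraph (multiple edges allowed; each edge has two distinct endpoints); $\delta(v)$ is the set of edges incident to $v$. An instance of VCHC (Vertex Cover with Hard Capacities) is $(V,E,k,m)$ with nonnegative integers $k_v$ (capacity of one copy of $v$) and $m_v$ (maximum number of copies of $v$). A feasible solution is $(x,y)$ with $x_v\in\{0,\dots,m_v\}$, $y(e,v)\in\{0,1\}$ for $e\in E,v\in e$, $\sum_{v\in e}y(e,v)=1$ for all $e$, and $|\{e:y(e,v)=1\}|\le k_vx_v$ for all $v$. The cost is $\sum_v x_v$, to be minimized. **LP1.** Minimize $\sum_{v}x_v$ subject to $\sum_{v\in e}y(e,v)=1$ ($e\in E$); $y(e,v)\le x_v$ ($e\in E,v\in e$); $\sum_{e\in\delta(v)}y(e,v)\le k_vx_v$ and $x_v\le m_v$ ($v\in V$); $x,y\ge 0$. **LP4** (for current $x^*,y^*$ and $T\subseteq E$). Variables $x_w$, $w\in W$. Minimize $\sum_{w\in W}x_w$ subject to $\sum_{w\in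 W}M(u,w)x_w\ge\sum_{w\in W}M(u,w)x^*_w$ ($u\in U$); $0\le x_w\le1$ ($w\in W$), where $M(u,w)=\sum_{e=uw\in E\setminus T}y^*(e,w)/x^*_w$. **Iterative Rounding Algorithm using Simpler Covering LPs for Graphs.** 1. Let $(x^*,y^*)$ be an optimal solution of LP1, $T=\emptyset$, $U=\{u:x^*_u\ge1/2\}$, $W=\{w:0<x^*_w<1/2\}$. The sets $U,W$ are never changed afterwards. 2. As long as there are $u\in U$ and $e\in\delta(u)\setminus T$ with $y^*(e,u)\cdot(\lceil x^*_u\rceil/x^*_u)\ge1$, add such an $e$ to $T$ ("via $u$"). 3. Let $x^*_{new}$ be an optimal extreme point of the current LP4 (with $x^*_{new,v}=x^*_v$ for $v\notin W$). 4. Let $x^t=(1-t)x^*+tx^*_{new}$, with $t$ increasing continuously from $0$ to $1$, and for $e=uw\notin T$ with $u\in U,w\in W$ let $y^t(e,w)=\frac{y^*(e,w)}{x^*_w}x^t_w$, $y^t(e,u)=1-y^t(e,w)$; other values of $y$ do not change. 5. Stop as soon as $y^t(e,u)\cdot(\lceil x^*_u\rceil/x^*_u)=1$ for some $u\in U$ and $e=uw\notin T$, $w\in W$, and add $e$ to $T$ (via $u$). 6. Put $(x^*,y^*)\leftarrow(x^t,y^t)$, update $M$, and repeat steps 3–6, until $t=1$ is reached without stopping. 7. Output $\bar x_v=\lceil x^*_v\rceil$ for all $v$, with $\bar y(e,v)=y^*(e,v)$ for $e\notin T$, $v\in e$; and for $e\in T$ added via $u$, $\bar y(e,u)=1$ and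 $\bar y(e,v)=0$ for the other endpoint $v$. The ratios $y^*(e,w)/x^*_w$ ($w\in W$) keep their initial LP1 values throughout; by convention this value is also used if $x^*_w$ becomes $0$.
   Formalization: The linear programs are taken over the rational numbers: the optimal solution of LP1 chosen in step 1, the extreme points of LP4 and the stopping times t are rational, so runs started from an irrational optimal solution of LP1 are not covered. -}

module Defs where

open import Data.Bool.Base using (if_then_else_)
open import Data.Fin.Base using (Fin; toℕ)
open import Data.Fin.Patterns using (1F)
import Data.Fin.Properties as Fin
open import Data.Integer.Base as ℤ using (ℤ; +_)
import Data.Integer.Properties as ℤ
open import Data.List.Base using (length; filter; allFin)
open import Data.Maybe.Base using (Maybe; just; nothing)
import Data.Maybe.Properties as Maybe
open import Data.Nat.Base as ℕ using (ℕ)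
open import Data.Product.Base using (_×_; ∃-syntax)
open import Data.Rational using (ℚ; 0ℚ; 1ℚ; ½; _+_; _-_; _*_; _÷_; _/_; _≤_; _<_;
                                 _≥_; _≤?_; _<?_; _≟_; ceiling; ≢-nonZero)
import Data.Rational.Properties as ℚ
open import Data.Sum.Base using (_⊎_)
open import Data.Vec.Functional using (Vector; replicate; updateAt)
open import Function.Base using (const)
open import Relation.Binary.Construct.Closure.ReflexiveTransitive using (Star)
open import Relation.Binary.PropositionalEquality.Core using (_≡_; _≢_)
open import Relation.Nullary using (¬_; Dec; does; yes; no)
open import Relation.Nullary.Decidable using (_×-dec_; _⊎-dec_)
open import Relation.Unary using (Pred; Decidable)

open import Algebra.Properties.CommutativeMonoid.Sum ℚ.+-0-commutativeMonoid public
  using () renaming (sum to sumℚ)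
open import Algebra.Properties.CommutativeMonoid.Sum ℤ.+-0-commutativeMonoid public
  using () renaming (sum to sumℤ)

∑∈ : ∀ {n p} {P : Pred (Fin n) p} → Decidable P → Vector ℚ n → ℚ
∑∈ P? f = sumℚ λ i → if does (P? i) then f i else 0ℚ

fromℤ : ℤ → ℚ
fromℤ z = z / 1

-- Total division; the algorithm only divides by x u with x u ≥ ½ and by x w
-- with x w > 0, so the value at denominator 0 is never used.
infixl 7 _÷₀_
_÷₀_ : ℚ → ℚ → ℚ
p ÷₀ q with q ≟ 0ℚ
... | yes _   = 0ℚ
... | no q≢0 = (p ÷ q) {{≢-nonZero q≢0}}

-- The order of the two endpoints of an edge is only a way of naming them;
-- all notions below are symmetric in end₁ and end₂.
record Instance : Set where
  field
    #V #E     : ℕ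
    end₁ end₂ : Fin #E → Fin #V
    loopless  : ∀ e → end₁ e ≢ end₂ e
    k m       : Fin #V → ℕ

  V E : Set
  V = Fin #V
  E = Fin #E

  infix 4 _∈ₑ_ _∈ₑ?_
  _∈ₑ_ : V → E → Set
  v ∈ₑ e = v ≡ end₁ e ⊎ v ≡ end₂ e

  _∈ₑ?_ : ∀ v e → Dec (v ∈ₑ e)
  v ∈ₑ? e = (v Fin.≟ end₁ e) ⊎-dec (v Fin.≟ end₂ e)

  Joins : E → V → V → Set
  Joins e u w = (u ≡ end₁ e × w ≡ end₂ e) ⊎ (u ≡ end₂ e × w ≡ end₁ e)

  joins? : ∀ e u w → Dec (Joins e u w)
  joins? e u w = ((u Fin.≟ end₁ e) ×-dec (w Fin.≟ end₂ e))
           ⊎-dec ((u Fin.≟ end₂ e) ×-dec (w Fin.≟ end₁ e))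

  -- The endpoint of e other than v, when v ∈ₑ e.
  opposite : E → V → V
  opposite e v = if does (v Fin.≟ end₁ e) then end₂ e else end₁ e

-- Assignments y are functions of all pairs (e , v), but every condition
-- refers to y e v only for v ∈ₑ e.

module VCHC (I : Instance) where
  open Instance I

  -- x is ℤ-valued so that the rounded vector ⌈ x* ⌉ can be used directly.
  record Feasible (x : V → ℤ) (y : E → V → Fin 2) : Set where
    field
      x≥0      : ∀ v → + 0 ℤ.≤ x v
      x≤m      : ∀ v → x v ℤ.≤ + m v
      assigned : ∀ e → toℕ (y e (end₁ e)) ℕ.+ toℕ (y e (end₂ e)) ≡ 1
      capacity : ∀ v → + length (filter (λ e → (v ∈ₑ? e) ×-dec (y e v Fin.≟ 1F)) (allFin #E))
                         ℤ.≤ + k v ℤ.* x v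

  cost : (V → ℤ) → ℤ
  cost = sumℤ

  record IsOPT (opt : ℤ) : Set where
    field
      attained : ∃[ x ] ∃[ y ] Feasible x y × cost x ≡ opt
      minimal  : ∀ x y → Feasible x y → opt ℤ.≤ cost x

module LP1 (I : Instance) where
  open Instance I

  record Feasible (x : V → ℚ) (y : E → V → ℚ) : Set where
    field
      assigned : ∀ e → y e (end₁ e) + y e (end₂ e) ≡ 1ℚ
      y≤x      : ∀ e v → v ∈ₑ e → y e v ≤ x v
      capacity : ∀ v → ∑∈ (v ∈ₑ?_) (λ e → y e v) ≤ fromℤ (+ k v) * x v
      x≤m      : ∀ v → x v ≤ fromℤ (+ m v)
      x≥0      : ∀ v → 0ℚ ≤ x v
      y≥0      : ∀ e v → v ∈ₑ e → 0ℚ ≤ y e v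

  record Optimal (x : V → ℚ) (y : E → V → ℚ) : Set where
    field
      feasible : Feasible x y
      minimal  : ∀ x′ y′ → Feasible x′ y′ → sumℚ x ≤ sumℚ x′

-- The algorithm makes choices (optimal solutions, edges), so it is described
-- as a relation between an instance and its possible outputs; (x⁰ , y⁰) is
-- the LP1 solution chosen at the start.
module Rounding (I : Instance)
                (x⁰ : Instance.V I → ℚ) (y⁰ : Instance.E I → Instance.V I → ℚ) where
  open Instance I

  U W : V → Set
  U v = ½ ≤ x⁰ v
  W v = 0ℚ < x⁰ v × x⁰ v < ½

  U? : Decidable U
  U? v = ½ ≤? x⁰ v

  W? : Decidable W
  W? v = (0ℚ <? x⁰ v) ×-dec (x⁰ v <? ½)

  -- y*(e,w)/x*_w for w ∈ W, which the algorithm keeps at its initial value.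
  ratio : E → V → ℚ
  ratio e w = y⁰ e w ÷₀ x⁰ w

  -- T e ≡ nothing means e ∉ T; T e ≡ just u means e was added to T via u.
  record State : Set where
    constructor state
    field
      x : V → ℚ
      y : E → V → ℚ
      T : Vector (Maybe V) #E

  infix 4 _∉_ _∉?_
  _∉_ : E → Vector (Maybe V) #E → Set
  e ∉ T = T e ≡ nothing

  _∉?_ : ∀ e T → Dec (e ∉ T)
  e ∉? T = Maybe.≡-dec Fin._≟_ (T e) nothing

  addVia : E → V → Vector (Maybe V) #E → Vector (Maybe V) #E
  addVia e u T = updateAt T e (const (just u))

  initial : State
  initial = state x⁰ y⁰ (replicate #E nothing)

  boost : (V → ℚ) → V → ℚ
  boost x u = fromℤ (ceiling (x u)) ÷₀ x u

  Addable : State → E → V → Set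
  Addable (state x y T) e u = U u × u ∈ₑ e × e ∉ T × y e u * boost x u ≥ 1ℚ

  data _⟶_ : State → State → Set where
    add : ∀ {x y T} e u → Addable (state x y T) e u →
          state x y T ⟶ state x y (addVia e u T)

  Step2 : State → State → Set
  Step2 s s′ = Star _⟶_ s s′ × (∀ e u → ¬ Addable s′ e u)

  module LP4 (s : State) where
    open State s

    M : V → V → ℚ
    M u w = ∑∈ (λ e → joins? e u w ×-dec (e ∉? T)) (λ e → ratio e w)

    -- The variables of LP4 are the entries z w with w ∈ W.
    record Feasible (z : V → ℚ) : Set where
      field
        cover : ∀ u → U u → ∑∈ W? (λ w → M u w * z w) ≥ ∑∈ W? (λ w → M u w * x w)
        z≥0   : ∀ w → W w → 0ℚ ≤ z w
        z≤1   : ∀ w → W w → z w ≤ 1ℚ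

    record OptimalExtremePoint (z : V → ℚ) : Set where
      field
        feasible : Feasible z
        minimal  : ∀ z′ → Feasible z′ → ∑∈ W? z ≤ ∑∈ W? z′
        extreme  : ∀ a b λ′ → Feasible a → Feasible b → 0ℚ < λ′ → λ′ < 1ℚ →
                   (∀ w → W w → z w ≡ (1ℚ - λ′) * a w + λ′ * b w) →
                   ∀ w → W w → a w ≡ b w

    record Target (xnew : V → ℚ) : Set where
      field
        optimal : OptimalExtremePoint xnew
        fixed   : ∀ v → ¬ W v → xnew v ≡ x v

  Moving : Vector (Maybe V) #E → E → V → V → Set
  Moving T e u w = e ∉ T × Joins e u w × U u × W w

  moving? : ∀ T e u w → Dec (Moving T e u w)
  moving? T e u w = (e ∉? T) ×-dec joins? e u w ×-dec U? u ×-dec W? w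

  module _ (s : State) (xnew : V → ℚ) (t : ℚ) where
    open State s

    xᵗ : V → ℚ
    xᵗ v = (1ℚ - t) * x v + t * xnew v

    yᵗ : E → V → ℚ
    yᵗ e v =
      if does (moving? T e (opposite e v) v) then ratio e v * xᵗ v
      else if does (moving? T e v (opposite e v))
        then 1ℚ - ratio e (opposite e v) * xᵗ (opposite e v)
      else y e v

    Hit : E → V → Set
    Hit e u = ∃[ w ] Moving T e u w × yᵗ e u * boost x u ≡ 1ℚ

  data Steps3-6 : State → State → Set where
    stop : ∀ {s s′} xnew t e u → LP4.Target s xnew →
           0ℚ ≤ t → t ≤ 1ℚ → Hit s xnew t e u →
           (∀ t′ e′ u′ → 0ℚ ≤ t′ → t′ < t → ¬ Hit s xnew t′ e′ u′) →
           Steps3-6 (state (xᵗ s xnew t) (yᵗ s xnew t) (addVia e u (State.T s))) s′ →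
           Steps3-6 s s′
    finish : ∀ {s} xnew → LP4.Target s xnew →
             (∀ t e u → 0ℚ ≤ t → t ≤ 1ℚ → ¬ Hit s xnew t e u) →
             Steps3-6 s (state (xᵗ s xnew 1ℚ) (yᵗ s xnew 1ℚ) (State.T s))

  x̄ : State → V → ℤ
  x̄ s v = ceiling (State.x s v)

  ȳ : State → E → V → ℚ
  ȳ s e v with State.T s e
  ... | nothing = State.y s e v
  ... | just u  = if does (v Fin.≟ u) then 1ℚ else 0ℚ

data Output (I : Instance) :
     (Instance.V I → ℤ) → (Instance.E I → Instance.V I → ℚ) → Set where
  output : ∀ x⁰ y⁰ → LP1.Optimal I x⁰ y⁰ → let open Rounding I x⁰ y⁰ in
           ∀ s s′ → Step2 initial s → Steps3-6 s s′ →
           Output I (x̄ s′) (ȳ s′)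

{-# OPTIONS --safe #-}

-- Throughout the algorithm the load ∑ y e u of u ∈ U stays at most k u * x⁰ u, because
-- the covering constraints of LP4 only let weight move from U to W, and an edge is put
-- into T via u only when ⌈ x u ⌉ / x u scales y e u up to at least 1.  So ȳ is a fractional
-- assignment respecting the capacities k v * ⌈ x v ⌉, and it can be made integral: the
-- fractional assignment gives the Hall-type condition that every set S of vertices spans
-- at most as many edges as the capacities in S allow, and this condition survives
-- assigning an edge to a suitable endpoint, by uncrossing tight sets.
--
-- For the cost, y e u * ⌈ x u ⌉ / x u ≤ 1 holds throughout for edges e = uw outside T, whence
-- 1 - 2 x w ≤ 2 x u - ⌈ x u ⌉ at the end: the rounding loss of w is paid by the rounding
-- slack of any such u.  At an extreme point of LP4 the tight constraints restricted to the
-- fractional w ∈ W have full column rank, and Gaussian elimination, pivoting on the column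
-- of largest loss, charges the fractional w to distinct u.
module Submission where

open import Defs
open import Data.Integer.Base using (+_; _*_; _≤_)
open import Data.Product.Base using (_×_; ∃-syntax)

import Algebra.Bundles as Bundles
import Algebra.Properties.CommutativeMonoid.Sum as Sum
import Algebra.Properties.CommutativeSemigroup as CommutativeSemigroup
import Algebra.Properties.Semiring.Sum as SemiringSum
open import Data.Bool.Base using (Bool; true; false; if_then_else_; _∧_; _∨_)
open import Data.Bool.Properties using (∧-comm)
open import Data.Empty using (⊥; ⊥-elim)
open import Data.Fin.Base using (Fin; zero; suc; toℕ; punchIn; punchOut; splitAt; _↑ˡ_; _↑ʳ_)
open import Data.Fin.Patterns using (0F; 1F)
import Data.Fin.Properties as Fin
open import Data.Fin.Subset using (Subset; ⁅_⁆; _∪_; _∩_)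
open import Data.Fin.Subset.Properties using (anySubset?)
open import Data.Integer.Base as ℤ using (ℤ; 0ℤ; 1ℤ)
import Data.Integer.DivMod as ℤ
import Data.Integer.Properties as ℤ
open import Data.List.Base using (length; filter; tabulate; allFin)
open import Data.Maybe.Base using (just; nothing)
open import Data.Maybe.Properties using (just-injective)
open import Data.Nat.Base as ℕ using (ℕ; zero; suc)
open import Data.Product.Base using (_,_; proj₁; proj₂)
open import Data.Rational.Base as ℚ using (ℚ; 0ℚ; 1ℚ; ½)
import Data.Rational.Properties as ℚ
open import Data.Rational.Solver using (module +-*-Solver)
import Data.Rational.Unnormalised.Base as ℚᵘ
import Data.Rational.Unnormalised.Properties as ℚᵘ
open import Data.Sum.Base using (_⊎_; inj₁; inj₂)
open import Data.Unit.Base using (tt)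
import Data.Vec.Base as Vec
import Data.Vec.Properties as Vec
open import Data.Vec.Functional using (Vector; removeAt; updateAt; insertAt; _∷_; _++_)
open import Data.Vec.Functional.Properties
  using (updateAt-updates; updateAt-minimal; insertAt-lookup; insertAt-punchIn; lookup-++ˡ; lookup-++ʳ)
open import Function.Base using (_∘_; id)
open import Relation.Binary.Construct.Closure.ReflexiveTransitive using (Star; _◅_) renaming (ε to done)
open import Relation.Binary.PropositionalEquality
open import Relation.Nullary using (¬_; Dec; does; yes; no)
open import Relation.Nullary.Decidable using (dec-true; dec-false; decidable-stable; ¬?; _×-dec_; _⊎-dec_)
open import Relation.Unary using (Pred; Decidable)

open +-*-Solver using (solve; con; _:+_; _:*_; _:-_; :-_; _:=_)
open CommutativeSemigroup ℤ.+-commutativeSemigroup using (interchange; x∙yz≈y∙xz)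
open Sum ℚ.+-0-commutativeMonoid using (sum-cong-≗; ∑-distrib-+; ∑-comm; sum-remove; sum-replicate-zero)
module ∑ℤ = Sum ℤ.+-0-commutativeMonoid
module ∑ℚ = SemiringSum (Bundles.CommutativeRing.semiring ℚ.+-*-commutativeRing)

-- The threshold `½` serves twice: it gives `⌈ q ⌉ ≤ 2 q` for `q = x u`, so every `u ∈ U` has
-- nonnegative slack to spend; and since `y⁰ e w ≤ x⁰ w < ½`, each edge at `w ∈ W` trades weight
-- with a vertex of `U`, whose load LP4 controls. LP4 has no constraint for the capacities of `W`,
-- because the ratios at `w` sum to at most `k w` by LP1, so `y e w = ratio e w * x w` loads `w`
-- with at most `k w * x w` wherever `x w` moves. A jump straight to the extreme point could push
-- some `y e u * ⌈ x u ⌉ / x u` past 1, and then the slack of `u` need no longer pay for `w`. This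
-- quantity is affine in `t`, so stopping when it first equals 1 keeps it at most 1 on all edges
-- outside `T`; the edge put into `T` disappears from LP4, and a nonzero entry of `M` always comes
-- from an edge that still obeys the bound. Coordinates 0 and 1 of the extreme point have
-- `⌈ x w ⌉ - 2 x w` equal to 0 and -1, so only the fractional ones need a payer.

module _ {a p} {A : Set a} {P : Set p} where

  if-elim : ∀ {q} (Q : A → Set q) (P? : Dec P) {x y} → (P → Q x) → (¬ P → Q y) → Q (if does P? then x else y)
  if-elim Q (yes p) Qx Qy = Qx p
  if-elim Q (no ¬p) Qx Qy = Qy ¬p

  if-yes : ∀ (P? : Dec P) {x y : A} → P → (if does P? then x else y) ≡ x
  if-yes P? {x} p = if-elim (_≡ x) P? (λ _ → refl) (λ ¬p → ⊥-elim (¬p p))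

  if-no : ∀ (P? : Dec P) {x y : A} → ¬ P → (if does P? then x else y) ≡ y
  if-no P? {x} {y} ¬p = if-elim (_≡ y) P? (λ p → ⊥-elim (¬p p)) (λ _ → refl)

-- Integers inside the rationals, and the ceiling

toℚᵘ-fromℤ : ∀ z → ℚ.toℚᵘ (fromℤ z) ℚᵘ.≃ ℚᵘ.mkℚᵘ z 0
toℚᵘ-fromℤ z = ℚ.toℚᵘ-fromℚᵘ (ℚᵘ.mkℚᵘ z 0)

fromℤ-mono-≤ : ∀ {a b} → a ℤ.≤ b → fromℤ a ℚ.≤ fromℤ b
fromℤ-mono-≤ {a} {b} a≤b = ℚ.toℚᵘ-cancel-≤
  (ℚᵘ.≤-respˡ-≃ (ℚᵘ.≃-sym (toℚᵘ-fromℤ a)) (ℚᵘ.≤-respʳ-≃ (ℚᵘ.≃-sym (toℚᵘ-fromℤ b))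
    (ℚᵘ.*≤* (subst₂ ℤ._≤_ (sym (ℤ.*-identityʳ a)) (sym (ℤ.*-identityʳ b)) a≤b))))

fromℤ-cancel-≤ : ∀ {a b} → fromℤ a ℚ.≤ fromℤ b → a ℤ.≤ b
fromℤ-cancel-≤ {a} {b} a≤b = subst₂ ℤ._≤_ (ℤ.*-identityʳ a) (ℤ.*-identityʳ b) (ℚᵘ.drop-*≤*
  (ℚᵘ.≤-respˡ-≃ (toℚᵘ-fromℤ a) (ℚᵘ.≤-respʳ-≃ (toℚᵘ-fromℤ b) (ℚ.toℚᵘ-mono-≤ a≤b))))

0≤fromℕ : ∀ n → 0ℚ ℚ.≤ fromℤ (+ n)
0≤fromℕ n = fromℤ-mono-≤ {+ 0} {+ n} (ℤ.+≤+ ℕ.z≤n)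

fromℤ-+ : ∀ a b → fromℤ (a ℤ.+ b) ≡ fromℤ a ℚ.+ fromℤ b
fromℤ-+ a b = ℚ.toℚᵘ-injective (begin
  ℚ.toℚᵘ (fromℤ (a ℤ.+ b))                    ≈⟨ toℚᵘ-fromℤ (a ℤ.+ b) ⟩
  ℚᵘ.mkℚᵘ (a ℤ.+ b) 0                         ≈⟨ ℚᵘ.*≡* (cong (ℤ._* + 1) (cong₂ ℤ._+_ (ℤ.*-identityʳ a) (ℤ.*-identityʳ b))) ⟨
  ℚᵘ.mkℚᵘ a 0 ℚᵘ.+ ℚᵘ.mkℚᵘ b 0                ≈⟨ ℚᵘ.+-cong (toℚᵘ-fromℤ a) (toℚᵘ-fromℤ b) ⟨
  ℚ.toℚᵘ (fromℤ a) ℚᵘ.+ ℚ.toℚᵘ (fromℤ b)      ≈⟨ ℚ.toℚᵘ-homo-+ (fromℤ a) (fromℤ b) ⟨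
  ℚ.toℚᵘ (fromℤ a ℚ.+ fromℤ b)                ∎)
  where open ℚᵘ.≃-Reasoning

fromℤ-* : ∀ a b → fromℤ (a ℤ.* b) ≡ fromℤ a ℚ.* fromℤ b
fromℤ-* a b = ℚ.toℚᵘ-injective (begin
  ℚ.toℚᵘ (fromℤ (a ℤ.* b))                    ≈⟨ toℚᵘ-fromℤ (a ℤ.* b) ⟩
  ℚᵘ.mkℚᵘ a 0 ℚᵘ.* ℚᵘ.mkℚᵘ b 0                ≈⟨ ℚᵘ.*-cong (toℚᵘ-fromℤ a) (toℚᵘ-fromℤ b) ⟨
  ℚ.toℚᵘ (fromℤ a) ℚᵘ.* ℚ.toℚᵘ (fromℤ b)      ≈⟨ ℚ.toℚᵘ-homo-* (fromℤ a) (fromℤ b) ⟨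
  ℚ.toℚᵘ (fromℤ a ℚ.* fromℤ b)                ∎)
  where open ℚᵘ.≃-Reasoning

fromℤ-sum : ∀ {n} (f : Fin n → ℤ) → fromℤ (sumℤ f) ≡ sumℚ (fromℤ ∘ f)
fromℤ-sum {zero}  f = refl
fromℤ-sum {suc n} f = trans (fromℤ-+ (f zero) _) (cong (fromℤ (f zero) ℚ.+_) (fromℤ-sum (f ∘ suc)))

private
  p≤z⇒↥p≤z*↧p : ∀ p z → p ℚ.≤ fromℤ z → ℚ.↥ p ℤ.≤ z ℤ.* ℚ.↧ p
  p≤z⇒↥p≤z*↧p p@record{} z p≤z = subst (ℤ._≤ z ℤ.* ℚ.↧ p) (ℤ.*-identityʳ _)
    (ℚᵘ.drop-*≤* (ℚᵘ.≤-respʳ-≃ (toℚᵘ-fromℤ z) (ℚ.toℚᵘ-mono-≤ p≤z)))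

  ↥p≤z*↧p⇒p≤z : ∀ p z → ℚ.↥ p ℤ.≤ z ℤ.* ℚ.↧ p → p ℚ.≤ fromℤ z
  ↥p≤z*↧p⇒p≤z p@record{} z h = ℚ.toℚᵘ-cancel-≤ (ℚᵘ.≤-respʳ-≃ (ℚᵘ.≃-sym (toℚᵘ-fromℤ z))
    (ℚᵘ.*≤* (subst (ℤ._≤ z ℤ.* ℚ.↧ p) (sym (ℤ.*-identityʳ _)) h)))

  -- Splitting on the sign of the numerator lets the negation inside `ceiling` reduce; the quotient
  -- is then brought to the form `/ℕ`, for which the division bounds are stated.
  ceiling≡ : ∀ p → ℚ.ceiling p ≡ ℤ.- ((ℤ.- ℚ.↥ p) ℤ./ℕ ℚ.↧ₙ p)
  ceiling≡ (ℚ.mkℚ (+ zero)     d _) = cong ℤ.-_ (ℤ.div-pos-is-/ℕ (+ 0) (suc d))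
  ceiling≡ (ℚ.mkℚ (+ suc n)    d _) = cong ℤ.-_ (ℤ.div-pos-is-/ℕ (ℤ.-[1+ n ]) (suc d))
  ceiling≡ (ℚ.mkℚ ℤ.-[1+ n ]   d _) = cong ℤ.-_ (ℤ.div-pos-is-/ℕ (+ suc n) (suc d))

p≤⌈p⌉ : ∀ p → p ℚ.≤ fromℤ (ℚ.ceiling p)
p≤⌈p⌉ p = ↥p≤z*↧p⇒p≤z p (ℚ.ceiling p) (begin
  ℚ.↥ p                  ≡⟨ ℤ.neg-involutive _ ⟨
  ℤ.- (ℤ.- ℚ.↥ p)        ≤⟨ ℤ.neg-mono-≤ (ℤ.[n/ℕd]*d≤n (ℤ.- ℚ.↥ p) (ℚ.↧ₙ p)) ⟩
  ℤ.- (q ℤ.* ℚ.↧ p)      ≡⟨ ℤ.neg-distribˡ-* q (ℚ.↧ p) ⟩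
  ℤ.- q ℤ.* ℚ.↧ p        ≡⟨ cong (ℤ._* ℚ.↧ p) (ceiling≡ p) ⟨
  ℚ.ceiling p ℤ.* ℚ.↧ p  ∎)
  where
  open ℤ.≤-Reasoning
  q = (ℤ.- ℚ.↥ p) ℤ./ℕ ℚ.↧ₙ p

ceiling-least : ∀ {p z} → p ℚ.≤ fromℤ z → ℚ.ceiling p ℤ.≤ z
ceiling-least {p} {z} p≤z = begin
  ℚ.ceiling p      ≡⟨ ceiling≡ p ⟩
  ℤ.- q            ≤⟨ ℤ.neg-mono-≤ -z≤q ⟩
  ℤ.- (ℤ.- z)      ≡⟨ ℤ.neg-involutive z ⟩
  z                ∎
  where
  open ℤ.≤-Reasoning
  q = (ℤ.- ℚ.↥ p) ℤ./ℕ ℚ.↧ₙ p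
  -- The numerator bound only gives the strict inequality against the successor of the floor `q` of
  -- `- p`; integrality turns it into `- z ≤ q`.
  -z<1+q : ℤ.- z ℤ.< ℤ.suc q
  -z<1+q = ℤ.*-cancelʳ-<-nonNeg (ℚ.↧ p) (begin-strict
    ℤ.- z ℤ.* ℚ.↧ p     ≡⟨ ℤ.neg-distribˡ-* z (ℚ.↧ p) ⟨
    ℤ.- (z ℤ.* ℚ.↧ p)   ≤⟨ ℤ.neg-mono-≤ (p≤z⇒↥p≤z*↧p p z p≤z) ⟩
    ℤ.- ℚ.↥ p           <⟨ ℤ.n<s[n/ℕd]*d (ℤ.- ℚ.↥ p) (ℚ.↧ₙ p) ⟩
    ℤ.suc q ℤ.* ℚ.↧ p   ∎)
  -z≤q : ℤ.- z ℤ.≤ q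
  -z≤q = subst (ℤ.- z ℤ.≤_) (ℤ.pred-suc q) (ℤ.i<j⇒i≤pred[j] -z<1+q)

-- Ordered-field arithmetic

≤-by : ∀ {p q} d → 0ℚ ℚ.≤ d → p ℚ.+ d ≡ q → p ℚ.≤ q
≤-by {p} d 0≤d refl = subst (ℚ._≤ p ℚ.+ d) (ℚ.+-identityʳ p) (ℚ.+-monoʳ-≤ p 0≤d)

0≤-diff : ∀ {p q} → p ℚ.≤ q → 0ℚ ℚ.≤ q ℚ.- p
0≤-diff {p} {q} p≤q = subst (ℚ._≤ q ℚ.- p) (ℚ.+-inverseʳ p) (ℚ.+-monoˡ-≤ (ℚ.- p) p≤q)

0≤+ : ∀ {p q} → 0ℚ ℚ.≤ p → 0ℚ ℚ.≤ q → 0ℚ ℚ.≤ p ℚ.+ q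
0≤+ = ℚ.+-mono-≤

0≤* : ∀ {p q} → 0ℚ ℚ.≤ p → 0ℚ ℚ.≤ q → 0ℚ ℚ.≤ p ℚ.* q
0≤* {p} {q} 0≤p 0≤q = ℚ.nonNegative⁻¹ (p ℚ.* q) ⦃ ℚ.nonNeg*nonNeg⇒nonNeg p ⦃ ℚ.nonNegative 0≤p ⦄ q ⦃ ℚ.nonNegative 0≤q ⦄ ⦄

*-monoˡ : ∀ {r p q} → 0ℚ ℚ.≤ r → p ℚ.≤ q → r ℚ.* p ℚ.≤ r ℚ.* q
*-monoˡ {r} 0≤r = ℚ.*-monoˡ-≤-nonNeg r ⦃ ℚ.nonNegative 0≤r ⦄

*-monoʳ : ∀ {r p q} → 0ℚ ℚ.≤ r → p ℚ.≤ q → p ℚ.* r ℚ.≤ q ℚ.* r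
*-monoʳ {r} 0≤r = ℚ.*-monoʳ-≤-nonNeg r ⦃ ℚ.nonNegative 0≤r ⦄

÷₀-* : ∀ p {q} → q ≢ 0ℚ → p ÷₀ q ℚ.* q ≡ p
÷₀-* p {q} q≢0 with q ℚ.≟ 0ℚ
... | yes q≡0 = ⊥-elim (q≢0 q≡0)
... | no  q≢0 = trans (ℚ.*-assoc p _ q) (trans (cong (p ℚ.*_) (ℚ.*-inverseˡ q ⦃ ℚ.≢-nonZero q≢0 ⦄)) (ℚ.*-identityʳ p))

p≤∣p∣ : ∀ p → p ℚ.≤ ℚ.∣ p ∣
p≤∣p∣ p with ℚ.≤-total 0ℚ p
... | inj₁ 0≤p = ℚ.≤-reflexive (sym (ℚ.0≤p⇒∣p∣≡p 0≤p))
... | inj₂ p≤0 = ℚ.≤-trans p≤0 (ℚ.0≤∣p∣ p)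

÷₀-pos : ∀ {p q} → 0ℚ ℚ.< p → 0ℚ ℚ.< q → 0ℚ ℚ.< p ÷₀ q
÷₀-pos {p} {q} 0<p 0<q = ℚ.*-cancelʳ-<-nonNeg q ⦃ ℚ.nonNegative (ℚ.<⇒≤ 0<q) ⦄
  (subst₂ ℚ._<_ (sym (ℚ.*-zeroˡ q)) (sym (÷₀-* p (≢-sym (ℚ.<⇒≢ 0<q)))) 0<p)

⊓-pos : ∀ {p q} → 0ℚ ℚ.< p → 0ℚ ℚ.< q → 0ℚ ℚ.< p ℚ.⊓ q
⊓-pos {p} {q} 0<p 0<q with ℚ.⊓-sel p q
... | inj₁ eq = subst (0ℚ ℚ.<_) (sym eq) 0<p
... | inj₂ eq = subst (0ℚ ℚ.<_) (sym eq) 0<q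

0<1 : 0ℚ ℚ.< 1ℚ
0<1 = ℚ.positive⁻¹ 1ℚ

½<1 : ½ ℚ.< 1ℚ
½<1 = ℚ.*<* (ℤ.+<+ (ℕ.s≤s (ℕ.s≤s ℕ.z≤n)))

≤∧≢⇒< : ∀ {p q} → p ℚ.≤ q → p ≢ q → p ℚ.< q
≤∧≢⇒< p≤q p≢q = ℚ.≰⇒> λ q≤p → p≢q (ℚ.≤-antisym p≤q q≤p)

diff≡0 : ∀ {p q} → p ℚ.- q ≡ 0ℚ → p ≡ q
diff≡0 {p} {q} eq = trans (solve 2 (λ p q → p := (p :- q) :+ q) refl p q) (trans (cong (ℚ._+ q) eq) (ℚ.+-identityˡ q))

*-cancelʳ : ∀ {r p q} → 0ℚ ℚ.< r → p ℚ.* r ℚ.≤ q ℚ.* r → p ℚ.≤ q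
*-cancelʳ {r} 0<r = ℚ.*-cancelʳ-≤-pos r ⦃ ℚ.positive 0<r ⦄

0≤1 : 0ℚ ℚ.≤ 1ℚ
0≤1 = ℚ.<⇒≤ 0<1

-- Has the same form as the entries of `xᵗ`, so that the lemmas below apply to them without
-- rewriting.
combination : ℚ → ℚ → ℚ → ℚ
combination t p q = (1ℚ ℚ.- t) ℚ.* p ℚ.+ t ℚ.* q

combination-same : ∀ t p → combination t p p ≡ p
combination-same = solve 2 (λ t p → (con 1ℚ :- t) :* p :+ t :* p := p) refl

module _ {t : ℚ} (0≤t : 0ℚ ℚ.≤ t) (t≤1 : t ℚ.≤ 1ℚ) where

  combination-mono : ∀ {p p′ q q′} → p ℚ.≤ p′ → q ℚ.≤ q′ → combination t p q ℚ.≤ combination t p′ q′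
  combination-mono p≤ q≤ = ℚ.+-mono-≤ (*-monoˡ (0≤-diff t≤1) p≤) (*-monoˡ 0≤t q≤)

  combination-≤ : ∀ {p q r} → p ℚ.≤ r → q ℚ.≤ r → combination t p q ℚ.≤ r
  combination-≤ {p} {q} {r} p≤r q≤r = subst (combination t p q ℚ.≤_) (combination-same t r) (combination-mono p≤r q≤r)

  combination-≥ : ∀ {p q r} → r ℚ.≤ p → r ℚ.≤ q → r ℚ.≤ combination t p q
  combination-≥ {p} {q} {r} r≤p r≤q = subst (ℚ._≤ combination t p q) (combination-same t r) (combination-mono r≤p r≤q)

-- θ = (1 - α) / (t γ) satisfies 0 ≤ θ < 1, and the affine function takes the value 1 at θ t.
crossing : ∀ α γ {t} → 0ℚ ℚ.≤ t → α ℚ.≤ 1ℚ → 1ℚ ℚ.< α ℚ.+ t ℚ.* γ →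
           ∃[ t′ ] 0ℚ ℚ.≤ t′ × t′ ℚ.< t × α ℚ.+ t′ ℚ.* γ ≡ 1ℚ
crossing α γ {t} 0≤t α≤1 1<αt = θ ℚ.* t , 0≤* 0≤θ 0≤t , θt<t , value
  where
  D = t ℚ.* γ
  1-α<D : 1ℚ ℚ.- α ℚ.< D
  1-α<D = subst₂ ℚ._<_ (ℚ.+-comm (ℚ.- α) 1ℚ) (solve 2 (λ a d → (:- a) :+ (a :+ d) := d) refl α D)
            (ℚ.+-monoʳ-< (ℚ.- α) 1<αt)
  0<D : 0ℚ ℚ.< D
  0<D = ℚ.≤-<-trans (0≤-diff α≤1) 1-α<D
  θ = (1ℚ ℚ.- α) ÷₀ D
  θD : θ ℚ.* D ≡ 1ℚ ℚ.- α
  θD = ÷₀-* (1ℚ ℚ.- α) (≢-sym (ℚ.<⇒≢ 0<D))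
  0≤θ : 0ℚ ℚ.≤ θ
  0≤θ = *-cancelʳ 0<D (subst₂ ℚ._≤_ (sym (ℚ.*-zeroˡ D)) (sym θD) (0≤-diff α≤1))
  0<t : 0ℚ ℚ.< t
  0<t = ≤∧≢⇒< 0≤t λ { refl → ℚ.<-irrefl (sym (ℚ.*-zeroˡ γ)) 0<D }
  θ<1 : θ ℚ.< 1ℚ
  θ<1 = ℚ.*-cancelʳ-<-nonNeg D ⦃ ℚ.nonNegative (ℚ.<⇒≤ 0<D) ⦄
          (subst₂ ℚ._<_ (sym θD) (sym (ℚ.*-identityˡ D)) 1-α<D)
  θt<t : θ ℚ.* t ℚ.< t
  θt<t = subst (θ ℚ.* t ℚ.<_) (ℚ.*-identityˡ t) (ℚ.*-monoˡ-<-pos t ⦃ ℚ.positive 0<t ⦄ θ<1)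
  value : α ℚ.+ θ ℚ.* t ℚ.* γ ≡ 1ℚ
  value = trans (cong (α ℚ.+_) (trans (ℚ.*-assoc θ t γ) θD)) (solve 1 (λ a → a :+ (con 1ℚ :- a) := con 1ℚ) refl α)

⌈_⌉ᵠ : ℚ → ℚ
⌈ q ⌉ᵠ = fromℤ (ℚ.ceiling q)

1≤⌈⌉ : ∀ {q} → 0ℚ ℚ.< q → 1ℚ ℚ.≤ ⌈ q ⌉ᵠ
1≤⌈⌉ {q} 0<q = fromℤ-mono-≤ {1ℤ} (ℤ.i<j⇒suc[i]≤j {0ℤ} {ℚ.ceiling q} (ℤ.≰⇒> λ ≤0 →
  ℚ.<-irrefl refl (ℚ.<-≤-trans 0<q (ℚ.≤-trans (p≤⌈p⌉ q) (fromℤ-mono-≤ ≤0)))))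

-- If the ceiling `n` is at most 1, then `1 = ½ + ½` suffices. Otherwise `n = 1 + (n - 1)`, where
-- `1 ≤ n - 1 ≤ q`.
⌈⌉≤double : ∀ {q} → ½ ℚ.≤ q → ⌈ q ⌉ᵠ ℚ.≤ q ℚ.+ q
⌈⌉≤double {q} ½≤q with ℚ.ceiling q ℤ.≤? 1ℤ
... | yes ≤1 = ℚ.≤-trans (fromℤ-mono-≤ ≤1) (ℚ.+-mono-≤ ½≤q ½≤q)
... | no ≰1 = begin
  fromℤ n                   ≡⟨ cong fromℤ (ℤ.suc-pred n) ⟨
  fromℤ (1ℤ ℤ.+ ℤ.pred n)   ≡⟨ fromℤ-+ 1ℤ (ℤ.pred n) ⟩
  1ℚ ℚ.+ fromℤ (ℤ.pred n)   ≤⟨ ℚ.+-mono-≤ (ℚ.≤-trans (fromℤ-mono-≤ (ℤ.i<j⇒i≤pred[j] (ℤ.≰⇒> ≰1))) n-1≤q) n-1≤q ⟩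
  q ℚ.+ q                   ∎
  where
  open ℚ.≤-Reasoning
  n = ℚ.ceiling q
  n-1≤q : fromℤ (ℤ.pred n) ℚ.≤ q
  n-1≤q = ℚ.<⇒≤ (ℚ.≰⇒> λ q≤n-1 → ℤ.<-irrefl refl (ℤ.i≤pred[j]⇒i<j {n} {n} (ceiling-least q≤n-1)))

-- Finite sums

sum-mono : ∀ {n} {f g : Vector ℚ n} → (∀ i → f i ℚ.≤ g i) → sumℚ f ℚ.≤ sumℚ g
sum-mono {zero}  f≤g = ℚ.≤-refl
sum-mono {suc n} f≤g = ℚ.+-mono-≤ (f≤g zero) (sum-mono (f≤g ∘ suc))

sum-zero : ∀ {n} {f : Vector ℚ n} → (∀ i → f i ≡ 0ℚ) → sumℚ f ≡ 0ℚ
sum-zero {n} f≡0 = trans (sum-cong-≗ f≡0) (sum-replicate-zero n)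

sum-nonneg : ∀ {n} {f : Vector ℚ n} → (∀ i → 0ℚ ℚ.≤ f i) → 0ℚ ℚ.≤ sumℚ f
sum-nonneg {n} {f} 0≤f = subst (ℚ._≤ sumℚ f) (sum-replicate-zero n) (sum-mono 0≤f)

*-distribˡ-sum : ∀ {n} r (f : Vector ℚ n) → r ℚ.* sumℚ f ≡ sumℚ (λ i → r ℚ.* f i)
*-distribˡ-sum = ∑ℚ.*-distribˡ-sum

term≤sum : ∀ {n} {f : Vector ℚ n} → (∀ i → 0ℚ ℚ.≤ f i) → ∀ i → f i ℚ.≤ sumℚ f
term≤sum {suc n} {f} 0≤f i = ≤-by (sumℚ (removeAt f i)) (sum-nonneg (λ j → 0≤f (punchIn i j))) (sym (sum-remove f))

sum-single : ∀ {n} (f : Vector ℚ n) i → (∀ j → j ≢ i → f j ≡ 0ℚ) → sumℚ f ≡ f i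
sum-single {suc n} f i f≡0 = begin
  sumℚ f                       ≡⟨ sum-remove {i = i} f ⟩
  f i ℚ.+ sumℚ (removeAt f i)  ≡⟨ cong (f i ℚ.+_) (sum-zero λ j → f≡0 (punchIn i j) (Fin.punchInᵢ≢i i j)) ⟩
  f i ℚ.+ 0ℚ                   ≡⟨ ℚ.+-identityʳ (f i) ⟩
  f i                          ∎
  where open ≡-Reasoning

sum-++ : ∀ {m n} (f : Vector ℚ m) (g : Vector ℚ n) → sumℚ (f ++ g) ≡ sumℚ f ℚ.+ sumℚ g
sum-++ {zero}      f g = sym (ℚ.+-identityˡ (sumℚ g))
sum-++ {suc m} {n} f g = begin
  f zero ℚ.+ sumℚ (λ i → (f ++ g) (suc i))       ≡⟨ cong (f zero ℚ.+_) (sum-cong-≗ shift) ⟩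
  f zero ℚ.+ sumℚ ((f ∘ suc) ++ g)               ≡⟨ cong (f zero ℚ.+_) (sum-++ (f ∘ suc) g) ⟩
  f zero ℚ.+ (sumℚ (f ∘ suc) ℚ.+ sumℚ g)         ≡⟨ ℚ.+-assoc (f zero) (sumℚ (f ∘ suc)) (sumℚ g) ⟨
  f zero ℚ.+ sumℚ (f ∘ suc) ℚ.+ sumℚ g           ∎
  where
  open ≡-Reasoning
  shift : ∀ i → (f ++ g) (suc i) ≡ ((f ∘ suc) ++ g) i
  shift i with splitAt m i
  ... | inj₁ _ = refl
  ... | inj₂ _ = refl

module _ {n p} {P : Pred (Fin n) p} (P? : Decidable P) where

  ∑∈-cong : ∀ {f g : Vector ℚ n} → (∀ i → P i → f i ≡ g i) → ∑∈ P? f ≡ ∑∈ P? g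
  ∑∈-cong {f} {g} f≡g = sum-cong-≗ λ i → restrict i (P? i) (f≡g i)
    where
    restrict : ∀ i (d : Dec (P i)) → (P i → f i ≡ g i) →
               (if does d then f i else 0ℚ) ≡ (if does d then g i else 0ℚ)
    restrict i (yes p) eq = eq p
    restrict i (no _)  eq = refl

  ∑∈-mono : ∀ {f g : Vector ℚ n} → (∀ i → P i → f i ℚ.≤ g i) → ∑∈ P? f ℚ.≤ ∑∈ P? g
  ∑∈-mono {f} {g} f≤g = sum-mono λ i → restrict i (P? i) (f≤g i)
    where
    restrict : ∀ i (d : Dec (P i)) → (P i → f i ℚ.≤ g i) →
               (if does d then f i else 0ℚ) ℚ.≤ (if does d then g i else 0ℚ)
    restrict i (yes p) le = le p
    restrict i (no _)  le = ℚ.≤-refl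

  ∑∈-+ : ∀ (f g : Vector ℚ n) → ∑∈ P? (λ i → f i ℚ.+ g i) ≡ ∑∈ P? f ℚ.+ ∑∈ P? g
  ∑∈-+ f g = trans (sum-cong-≗ λ i → restrict i (does (P? i)))
    (∑-distrib-+ (λ i → if does (P? i) then f i else 0ℚ) (λ i → if does (P? i) then g i else 0ℚ))
    where
    restrict : ∀ i b → (if b then f i ℚ.+ g i else 0ℚ) ≡ (if b then f i else 0ℚ) ℚ.+ (if b then g i else 0ℚ)
    restrict i true  = refl
    restrict i false = refl

  ∑∈-* : ∀ r (f : Vector ℚ n) → ∑∈ P? (λ i → r ℚ.* f i) ≡ r ℚ.* ∑∈ P? f
  ∑∈-* r f = trans (sum-cong-≗ λ i → restrict i (does (P? i)))
    (sym (*-distribˡ-sum r (λ i → if does (P? i) then f i else 0ℚ)))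
    where
    restrict : ∀ i b → (if b then r ℚ.* f i else 0ℚ) ≡ r ℚ.* (if b then f i else 0ℚ)
    restrict i true  = refl
    restrict i false = sym (ℚ.*-zeroʳ r)

  -- Serves both the coverage along a step, with coefficients `1 - t` and `t`, and the coverage of a
  -- perturbed extreme point, with coefficients 1 and `± ε`.
  ∑∈-combine : ∀ (f g h : Vector ℚ n) r s →
    ∑∈ P? (λ i → f i ℚ.* (r ℚ.* g i ℚ.+ s ℚ.* h i)) ≡
    r ℚ.* ∑∈ P? (λ i → f i ℚ.* g i) ℚ.+ s ℚ.* ∑∈ P? (λ i → f i ℚ.* h i)
  ∑∈-combine f g h r s = begin
    ∑∈ P? (λ i → f i ℚ.* (r ℚ.* g i ℚ.+ s ℚ.* h i))                         ≡⟨ ∑∈-cong (λ i _ → distrib (f i) (g i) (h i) r s) ⟩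
    ∑∈ P? (λ i → r ℚ.* (f i ℚ.* g i) ℚ.+ s ℚ.* (f i ℚ.* h i))               ≡⟨ ∑∈-+ (λ i → r ℚ.* (f i ℚ.* g i)) (λ i → s ℚ.* (f i ℚ.* h i)) ⟩
    ∑∈ P? (λ i → r ℚ.* (f i ℚ.* g i)) ℚ.+ ∑∈ P? (λ i → s ℚ.* (f i ℚ.* h i)) ≡⟨ cong₂ ℚ._+_ (∑∈-* r (λ i → f i ℚ.* g i)) (∑∈-* s (λ i → f i ℚ.* h i)) ⟩
    r ℚ.* ∑∈ P? (λ i → f i ℚ.* g i) ℚ.+ s ℚ.* ∑∈ P? (λ i → f i ℚ.* h i)     ∎
    where
    open ≡-Reasoning
    distrib : ∀ f g h r s → f ℚ.* (r ℚ.* g ℚ.+ s ℚ.* h) ≡ r ℚ.* (f ℚ.* g) ℚ.+ s ℚ.* (f ℚ.* h)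
    distrib = solve 5 (λ f g h r s → f :* (r :* g :+ s :* h) := r :* (f :* g) :+ s :* (f :* h)) refl

sum-unit : ∀ {n} (f : Vector ℚ n) i → sumℚ (λ j → (if does (i Fin.≟ j) then 1ℚ else 0ℚ) ℚ.* f j) ≡ f i
sum-unit f i = trans (sum-single _ i λ j j≢i → trans (cong (ℚ._* f j) (if-no (i Fin.≟ j) (≢-sym j≢i))) (ℚ.*-zeroˡ (f j)))
                     (trans (cong (ℚ._* f i) (if-yes (i Fin.≟ i) refl)) (ℚ.*-identityˡ (f i)))

if-*-comm : ∀ b (p q : ℚ) → (if b then p else 0ℚ) ℚ.* q ≡ (if b then p ℚ.* q else 0ℚ)
if-*-comm true  p q = refl
if-*-comm false p q = ℚ.*-zeroˡ q

++-elim₂ : ∀ {m n} {A B : Set} (P : A → B → Set) (f : Vector A m) (g : Vector A n) (f′ : Vector B m) (g′ : Vector B n) →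
           (∀ i → P (f i) (f′ i)) → (∀ j → P (g j) (g′ j)) → ∀ i → P ((f ++ g) i) ((f′ ++ g′) i)
++-elim₂ {m} P f g f′ g′ Pf Pg i with splitAt m i
... | inj₁ j = Pf j
... | inj₂ j = Pg j

-- Integral orientations

indicator : Bool → ℤ
indicator b = if b then 1ℤ else 0ℤ

spanned : ∀ {n m} → (a b : Fin m → Fin n) → Subset n → ℤ
spanned a b S = sumℤ λ e → indicator (Vec.lookup S (a e) ∧ Vec.lookup S (b e))

load : ∀ {n m} → (Fin m → Fin n) → Fin n → ℤ
load h v = sumℤ λ e → indicator (does (v Fin.≟ h e))

total : ∀ {n} → (Fin n → ℤ) → Subset n → ℤ
total c S = sumℤ λ v → if Vec.lookup S v then c v else 0ℤ

total-⊥ : ∀ {n} (c : Fin n → ℤ) → total c (Vec.replicate n false) ≡ 0ℤ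
total-⊥ {zero}  c = refl
total-⊥ {suc n} c = trans (ℤ.+-identityˡ _) (total-⊥ (c ∘ suc))

total-⁅⁆ : ∀ {n} (c : Fin n → ℤ) v → total c ⁅ v ⁆ ≡ c v
total-⁅⁆ c zero    = trans (cong (λ z → c zero ℤ.+ z) (total-⊥ (c ∘ suc))) (ℤ.+-identityʳ (c zero))
total-⁅⁆ c (suc v) = trans (ℤ.+-identityˡ _) (total-⁅⁆ (c ∘ suc) v)

total-∪-∩ : ∀ {n} (c : Fin n → ℤ) S T → total c (S ∪ T) ℤ.+ total c (S ∩ T) ≡ total c S ℤ.+ total c T
total-∪-∩ {zero}  c Vec.[]      Vec.[]      = refl
total-∪-∩ {suc n} c (s Vec.∷ S) (t Vec.∷ T) = begin
  (at (s ∨ t) ℤ.+ total c′ (S ∪ T)) ℤ.+ (at (s ∧ t) ℤ.+ total c′ (S ∩ T)) ≡⟨ interchange (at (s ∨ t)) (total c′ (S ∪ T)) (at (s ∧ t)) (total c′ (S ∩ T)) ⟩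
  (at (s ∨ t) ℤ.+ at (s ∧ t)) ℤ.+ (total c′ (S ∪ T) ℤ.+ total c′ (S ∩ T)) ≡⟨ cong₂ ℤ._+_ (head-eq s t) (total-∪-∩ c′ S T) ⟩
  (at s ℤ.+ at t) ℤ.+ (total c′ S ℤ.+ total c′ T)                         ≡⟨ interchange (at s) (at t) (total c′ S) (total c′ T) ⟩
  (at s ℤ.+ total c′ S) ℤ.+ (at t ℤ.+ total c′ T)                         ∎
  where
  open ≡-Reasoning
  c′ = c ∘ suc
  at : Bool → ℤ
  at b = if b then c zero else 0ℤ
  head-eq : ∀ s t → at (s ∨ t) ℤ.+ at (s ∧ t) ≡ at s ℤ.+ at t
  head-eq true  t     = refl
  head-eq false true  = ℤ.+-comm (c zero) 0ℤ
  head-eq false false = refl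

decrement : ∀ {n} → Fin n → (Fin n → ℤ) → Fin n → ℤ
decrement u c = updateAt c u ℤ.pred

total-decrement : ∀ {n} (c : Fin n → ℤ) u S → total c S ≡ indicator (Vec.lookup S u) ℤ.+ total (decrement u c) S
total-decrement c zero    (true  Vec.∷ S) = trans (cong (ℤ._+ total (c ∘ suc) S) (sym (ℤ.suc-pred (c zero))))
                                              (ℤ.+-assoc 1ℤ (ℤ.pred (c zero)) (total (c ∘ suc) S))
total-decrement c zero    (false Vec.∷ S) = sym (ℤ.+-identityˡ _)
total-decrement c (suc u) (s     Vec.∷ S) = begin
  at ℤ.+ total (c ∘ suc) S                          ≡⟨ cong (λ z → at ℤ.+ z) (total-decrement (c ∘ suc) u S) ⟩
  at ℤ.+ (i ℤ.+ total (decrement u (c ∘ suc)) S)    ≡⟨ x∙yz≈y∙xz at i (total (decrement u (c ∘ suc)) S) ⟩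
  i ℤ.+ (at ℤ.+ total (decrement u (c ∘ suc)) S)    ∎
  where
  open ≡-Reasoning
  at = if s then c zero else 0ℤ
  i = indicator (Vec.lookup S u)

sumℤ-mono : ∀ {n} {f g : Fin n → ℤ} → (∀ i → f i ℤ.≤ g i) → sumℤ f ℤ.≤ sumℤ g
sumℤ-mono {zero}  f≤g = ℤ.≤-refl
sumℤ-mono {suc n} f≤g = ℤ.+-mono-≤ (f≤g zero) (sumℤ-mono (f≤g ∘ suc))

module _ {n m : ℕ} (a b : Fin m → Fin n) where

  -- Holds edge by edge: an edge within `S` or within `T` lies within the union, and within the
  -- intersection if it lies in both. Edges between the two differences only add to the right side.
  spanned-supermodular : ∀ S T → spanned a b S ℤ.+ spanned a b T ℤ.≤ spanned a b (S ∪ T) ℤ.+ spanned a b (S ∩ T)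
  spanned-supermodular S T = subst₂ ℤ._≤_
    (∑ℤ.∑-distrib-+ (spans S) (spans T)) (∑ℤ.∑-distrib-+ (spans (S ∪ T)) (spans (S ∩ T))) (sumℤ-mono pointwise)
    where
    spans : Subset n → Fin m → ℤ
    spans S e = indicator (Vec.lookup S (a e) ∧ Vec.lookup S (b e))
    bools : ∀ s s′ t t′ → indicator (s ∧ s′) ℤ.+ indicator (t ∧ t′) ℤ.≤
                          indicator ((s ∨ t) ∧ (s′ ∨ t′)) ℤ.+ indicator ((s ∧ t) ∧ (s′ ∧ t′))
    bools true  true  true  t′    = ℤ.≤-refl
    bools true  true  false t′    = ℤ.≤-refl
    bools true  false true  true  = ℤ.≤-refl
    bools true  false true  false = ℤ.≤-refl
    bools true  false false true  = ℤ.+≤+ ℕ.z≤n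
    bools true  false false false = ℤ.≤-refl
    bools false true  true  true  = ℤ.≤-refl
    bools false true  true  false = ℤ.+≤+ ℕ.z≤n
    bools false false true  true  = ℤ.≤-refl
    bools false false true  false = ℤ.≤-refl
    bools false true  false true  = ℤ.≤-refl
    bools false true  false false = ℤ.≤-refl
    bools false false false true  = ℤ.≤-refl
    bools false false false false = ℤ.≤-refl
    pointwise : ∀ e → spans S e ℤ.+ spans T e ℤ.≤ spans (S ∪ T) e ℤ.+ spans (S ∩ T) e
    pointwise e
      rewrite Vec.lookup-zipWith _∨_ (a e) S T | Vec.lookup-zipWith _∨_ (b e) S T
            | Vec.lookup-zipWith _∧_ (a e) S T | Vec.lookup-zipWith _∧_ (b e) S T
      = bools (Vec.lookup S (a e)) (Vec.lookup S (b e)) (Vec.lookup T (a e)) (Vec.lookup T (b e))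

-- Hakimi's condition for an orientation in which each `v` receives at most `c v` edges. Ranging
-- over vertex sets makes a violation decidable by searching all subsets.
Hall : ∀ {n m} → (a b : Fin m → Fin n) → (Fin n → ℤ) → Set
Hall a b c = ∀ S → spanned a b S ℤ.≤ total c S

violated? : ∀ {n m} (a b : Fin m → Fin n) c → Dec (∃[ S ] ¬ spanned a b S ℤ.≤ total c S)
violated? a b c = anySubset? λ S → ¬? (spanned a b S ℤ.≤? total c S)

0≤indicator : ∀ b → 0ℤ ℤ.≤ indicator b
0≤indicator true  = ℤ.+≤+ ℕ.z≤n
0≤indicator false = ℤ.+≤+ ℕ.z≤n

module _ {n m : ℕ} (a b : Fin (suc m) → Fin n) (c : Fin n → ℤ) (hall : Hall a b c) where
  private
    u = a zero
    v = b zero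
    spanned′ = spanned (a ∘ suc) (b ∘ suc)

    spanned′≤total : ∀ S → spanned′ S ℤ.≤ total c S
    spanned′≤total S = ℤ.≤-trans
      (subst (ℤ._≤ spanned a b S) (ℤ.+-identityˡ _) (ℤ.+-monoˡ-≤ (spanned′ S) (0≤indicator (Vec.lookup S u ∧ Vec.lookup S v))))
      (hall S)

  -- Giving the first edge to `w` lowers the right side by 1 exactly when `w ∈ S`, and dropping the
  -- edge lowers the left side when both ends lie in `S`. A new violation therefore needs `S` to
  -- contain `w` alone and to have had no room left. The hypothesis is passed explicitly so that the
  -- two ends can be exchanged.
  tight : ∀ w w′ S → (∀ S → indicator (Vec.lookup S w ∧ Vec.lookup S w′) ℤ.+ spanned′ S ℤ.≤ total c S) →
          ¬ spanned′ S ℤ.≤ total (decrement w c) S →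
          Vec.lookup S w ≡ true × Vec.lookup S w′ ≡ false × total c S ℤ.≤ spanned′ S
  tight w w′ S h ¬≤ with Vec.lookup S w | Vec.lookup S w′ | h S | total-decrement c w S
  ... | false | _     | h | eq = ⊥-elim (¬≤ (subst₂ ℤ._≤_ (ℤ.+-identityˡ _) (trans eq (ℤ.+-identityˡ _)) h))
  ... | true  | true  | h | eq = ⊥-elim (¬≤ (subst₂ ℤ._≤_ (ℤ.pred-suc _) (ℤ.pred-suc _) (ℤ.pred-mono (subst (1ℤ ℤ.+ spanned′ S ℤ.≤_) eq h))))
  ... | true  | false | h | eq = refl , refl ,
    subst (ℤ._≤ spanned′ S) (sym eq) (ℤ.i<j⇒suc[i]≤j (ℤ.≰⇒> ¬≤))

  -- Uncrossing: tight sets S ∋ u, S ∌ v and T ∋ v, T ∌ u would make S ∪ T violate Hall's condition.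
  assign-first : Hall (a ∘ suc) (b ∘ suc) (decrement u c) ⊎ Hall (a ∘ suc) (b ∘ suc) (decrement v c)
  assign-first with violated? (a ∘ suc) (b ∘ suc) (decrement u c) | violated? (a ∘ suc) (b ∘ suc) (decrement v c)
  ... | no ¬S       | _           = inj₁ λ S → decidable-stable (_ ℤ.≤? _) λ ¬≤ → ¬S (S , ¬≤)
  ... | yes _       | no ¬T       = inj₂ λ T → decidable-stable (_ ℤ.≤? _) λ ¬≤ → ¬T (T , ¬≤)
  ... | yes (S , ¬S) | yes (T , ¬T) = ⊥-elim (ℤ.<-irrefl refl (begin-strict
    total c S ℤ.+ total c T                         ≤⟨ ℤ.+-mono-≤ S-tight T-tight ⟩
    spanned′ S ℤ.+ spanned′ T                       ≤⟨ spanned-supermodular (a ∘ suc) (b ∘ suc) S T ⟩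
    spanned′ (S ∪ T) ℤ.+ spanned′ (S ∩ T)           <⟨ ℤ.+-mono-<-≤ ∪< (spanned′≤total (S ∩ T)) ⟩
    total c (S ∪ T) ℤ.+ total c (S ∩ T)             ≡⟨ total-∪-∩ c S T ⟩
    total c S ℤ.+ total c T                         ∎))
    where
    open ℤ.≤-Reasoning
    S-props = tight u v S hall ¬S
    T-props = tight v u T (λ S → subst (λ b → indicator b ℤ.+ spanned′ S ℤ.≤ total c S) (∧-comm (Vec.lookup S u) _) (hall S)) ¬T
    S-tight = proj₂ (proj₂ S-props)
    T-tight = proj₂ (proj₂ T-props)
    -- The first edge lies within `S ∪ T` but is not counted by `spanned′`, which makes the bound
    -- strict.
    ∪< : spanned′ (S ∪ T) ℤ.< total c (S ∪ T)
    ∪< with hall (S ∪ T)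
    ... | h rewrite Vec.lookup-zipWith _∨_ u S T | Vec.lookup-zipWith _∨_ v S T
                  | proj₁ S-props | proj₁ (proj₂ S-props) | proj₁ T-props = ℤ.suc[i]≤j⇒i<j h

load-∷ : ∀ {n m} c w (h : Fin m → Fin n) → (∀ v → load h v ℤ.≤ decrement w c v) → ∀ v → load (w ∷ h) v ℤ.≤ c v
load-∷ c w h h≤ v with v Fin.≟ w | h≤ v
... | yes refl | ≤pred = ℤ.≤-trans (ℤ.suc-mono (subst (load h v ℤ.≤_) (updateAt-updates v c) ≤pred)) (ℤ.≤-reflexive (ℤ.suc-pred (c v)))
... | no v≢w   | ≤c    = subst₂ ℤ._≤_ (sym (ℤ.+-identityˡ _)) (updateAt-minimal v w c v≢w) ≤c

orient : ∀ {n m} (a b : Fin m → Fin n) c → Hall a b c →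
         ∃[ h ] (∀ e → h e ≡ a e ⊎ h e ≡ b e) × (∀ v → load h v ℤ.≤ c v)
-- With no edges left, Hall's condition for singletons is the nonnegativity of the remaining
-- capacities.
orient {m = zero}  a b c hall = (λ ()) , (λ ()) , λ v → subst (0ℤ ℤ.≤_) (total-⁅⁆ c v) (hall ⁅ v ⁆)
orient {m = suc m} a b c hall with assign-first a b c hall
... | inj₁ hall′ = let h , h∈ , h≤ = orient (a ∘ suc) (b ∘ suc) _ hall′ in
  a zero ∷ h , (λ { zero → inj₁ refl ; (suc e) → h∈ e }) , load-∷ c (a zero) h h≤
... | inj₂ hall′ = let h , h∈ , h≤ = orient (a ∘ suc) (b ∘ suc) _ hall′ in
  b zero ∷ h , (λ { zero → inj₂ refl ; (suc e) → h∈ e }) , load-∷ c (b zero) h h≤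

-- Integral assignments from fractional ones

length-filter : ∀ {a p} {A : Set a} {P : Pred A p} (P? : Decidable P) {m} (f : Fin m → A) →
                + length (filter P? (tabulate f)) ≡ sumℤ λ i → indicator (does (P? (f i)))
length-filter P? {zero}  f = refl
length-filter P? {suc m} f with does (P? (f zero))
... | true  = cong ℤ.suc (length-filter P? (f ∘ suc))
... | false = trans (length-filter P? (f ∘ suc)) (sym (ℤ.+-identityˡ _))

pair≤sum : ∀ {n} (f : Vector ℚ n) → (∀ i → 0ℚ ℚ.≤ f i) → ∀ {i j} → i ≢ j → f i ℚ.+ f j ℚ.≤ sumℚ f
pair≤sum {suc n} f 0≤f {i} {j} i≢j = subst (f i ℚ.+ f j ℚ.≤_) (sym (sum-remove f))
  (ℚ.+-monoʳ-≤ (f i) (subst (λ k → f k ℚ.≤ sumℚ (removeAt f i)) (Fin.punchIn-punchOut i≢j)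
    (term≤sum (λ k → 0≤f (punchIn i k)) (punchOut i≢j))))

module _ (I : Instance) where
  open Instance I

  -- Double counting of the shares `y e v` with `v ∈ S`: an edge within `S` contributes its full 1,
  -- every other edge at least 0, and a vertex of `S` collects at most `c v`. Looplessness keeps the
  -- two shares of an edge apart.
  fractional⇒Hall : (y : E → V → ℚ) (c : V → ℤ) →
    (∀ e → y e (end₁ e) ℚ.+ y e (end₂ e) ≡ 1ℚ) →
    (∀ e v → v ∈ₑ e → 0ℚ ℚ.≤ y e v) →
    (∀ v → ∑∈ (v ∈ₑ?_) (λ e → y e v) ℚ.≤ fromℤ (c v)) →
    Hall end₁ end₂ c
  fractional⇒Hall y c y≡1 y≥0 y≤c S = fromℤ-cancel-≤ (begin
    fromℤ (spanned end₁ end₂ S)                         ≡⟨ fromℤ-sum spans ⟩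
    sumℚ (λ e → fromℤ (spans e))                        ≤⟨ sum-mono edge ⟩
    sumℚ (λ e → sumℚ (λ v → share e v))                 ≡⟨ ∑-comm share ⟩
    sumℚ (λ v → sumℚ (λ e → share e v))                 ≤⟨ sum-mono vertex ⟩
    sumℚ (λ v → fromℤ (inside v))                       ≡⟨ fromℤ-sum inside ⟨
    fromℤ (total c S)                                   ∎)
    where
    open ℚ.≤-Reasoning
    spans : E → ℤ
    spans e = indicator (Vec.lookup S (end₁ e) ∧ Vec.lookup S (end₂ e))
    inside : V → ℤ
    inside v = if Vec.lookup S v then c v else 0ℤ
    share : E → V → ℚ
    share e v = if Vec.lookup S v then (if does (v ∈ₑ? e) then y e v else 0ℚ) else 0ℚ

    share≥0 : ∀ e v → 0ℚ ℚ.≤ share e v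
    share≥0 e v with Vec.lookup S v
    ... | false = ℚ.≤-refl
    ... | true  = if-elim (0ℚ ℚ.≤_) (v ∈ₑ? e) (y≥0 e v) (λ _ → ℚ.≤-refl)

    share-end : ∀ e v → v ∈ₑ e → Vec.lookup S v ≡ true → share e v ≡ y e v
    share-end e v v∈e S∋v rewrite S∋v = if-yes (v ∈ₑ? e) v∈e

    edge : ∀ e → fromℤ (spans e) ℚ.≤ sumℚ (share e)
    edge e with Vec.lookup S (end₁ e) in p | Vec.lookup S (end₂ e) in q
    ... | false | _     = sum-nonneg (share≥0 e)
    ... | true  | false = sum-nonneg (share≥0 e)
    ... | true  | true  = begin
      1ℚ                                     ≡⟨ y≡1 e ⟨
      y e (end₁ e) ℚ.+ y e (end₂ e)          ≡⟨ cong₂ ℚ._+_ (share-end e _ (inj₁ refl) p) (share-end e _ (inj₂ refl) q) ⟨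
      share e (end₁ e) ℚ.+ share e (end₂ e)  ≤⟨ pair≤sum (share e) (share≥0 e) (loopless e) ⟩
      sumℚ (share e)                         ∎

    vertex : ∀ v → sumℚ (λ e → share e v) ℚ.≤ fromℤ (inside v)
    vertex v with Vec.lookup S v
    ... | true  = y≤c v
    ... | false = ℚ.≤-reflexive (sum-zero {f = λ (_ : E) → 0ℚ} λ _ → refl)

  integral-assignment : (x : V → ℤ) (y : E → V → ℚ) →
    (∀ v → + 0 ℤ.≤ x v) → (∀ v → x v ℤ.≤ + m v) →
    (∀ e → y e (end₁ e) ℚ.+ y e (end₂ e) ≡ 1ℚ) →
    (∀ e v → v ∈ₑ e → 0ℚ ℚ.≤ y e v) →
    (∀ v → ∑∈ (v ∈ₑ?_) (λ e → y e v) ℚ.≤ fromℤ (+ k v ℤ.* x v)) →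
    ∃[ y′ ] VCHC.Feasible I x y′
  integral-assignment x y x≥0 x≤m y≡1 y≥0 y≤kx = y′ , record
    { x≥0 = x≥0 ; x≤m = x≤m ; assigned = assigned ; capacity = capacity }
    where
    orientation = orient end₁ end₂ _ (fractional⇒Hall y (λ v → + k v ℤ.* x v) y≡1 y≥0 y≤kx)
    h = proj₁ orientation
    y′ : E → V → Fin 2
    y′ e v = if does (v Fin.≟ h e) then 1F else 0F

    assigned : ∀ e → toℕ (y′ e (end₁ e)) ℕ.+ toℕ (y′ e (end₂ e)) ≡ 1
    assigned e with proj₁ (proj₂ orientation) e
    ... | inj₁ eq rewrite eq | dec-true (end₁ e Fin.≟ end₁ e) refl
                        | dec-false (end₂ e Fin.≟ end₁ e) (loopless e ∘ sym) = refl
    ... | inj₂ eq rewrite eq | dec-true (end₂ e Fin.≟ end₂ e) refl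
                        | dec-false (end₁ e Fin.≟ end₂ e) (loopless e) = refl

    at : ∀ v e → Dec (v ∈ₑ e × y′ e v ≡ 1F)
    at v e = (v ∈ₑ? e) ×-dec (y′ e v Fin.≟ 1F)

    at≤load : ∀ v e → indicator (does (at v e)) ℤ.≤ indicator (does (v Fin.≟ h e))
    at≤load v e = if-elim (ℤ._≤ indicator (does (v Fin.≟ h e))) (at v e)
      (λ (_ , y≡1) → at-1 y≡1) (λ _ → 0≤indicator (does (v Fin.≟ h e)))
      where
      at-1 : y′ e v ≡ 1F → 1ℤ ℤ.≤ indicator (does (v Fin.≟ h e))
      at-1 y≡1 with does (v Fin.≟ h e)
      at-1 y≡1 | true = ℤ.≤-refl
      at-1 ()  | false

    capacity : ∀ v → _ ℤ.≤ + k v ℤ.* x v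
    capacity v = begin
      _                                          ≡⟨ length-filter (at v) id ⟩
      sumℤ (λ e → indicator (does (at v e)))     ≤⟨ sumℤ-mono (at≤load v) ⟩
      load h v                                   ≤⟨ proj₂ (proj₂ orientation) v ⟩
      + k v ℤ.* x v                              ∎
      where open ℤ.≤-Reasoning

-- Weights on the columns of a matrix of full column rank

-- Linear independence of the columns, in the form that extremality provides and elimination
-- preserves.
TrivialKernel : ∀ {r n} → (Fin r → Fin n → ℚ) → Set
TrivialKernel {n = n} M = ∀ (d : Fin n → ℚ) → (∀ u → sumℚ (λ w → M u w ℚ.* d w) ≡ 0ℚ) → ∀ w → d w ≡ 0ℚ

-- A zero column would put its unit vector into the kernel.
nonzero-column : ∀ {r n} (M : Fin r → Fin n → ℚ) → TrivialKernel M →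
                 ∀ w → ∃[ u ] M u w ≢ 0ℚ
nonzero-column {n = n} M ker w with Fin.any? (λ u → ¬? (M u w ℚ.≟ 0ℚ))
... | yes (u , Muw≢0) = u , Muw≢0
... | no  none = ⊥-elim (ℚ.1≢0 (trans (sym (cong (λ b → if b then 1ℚ else 0ℚ) (dec-true (w Fin.≟ w) refl)))
                                      (ker unit (λ u → sum-zero (vanish u)) w)))
  where
  unit : Fin n → ℚ
  unit w′ = if does (w Fin.≟ w′) then 1ℚ else 0ℚ
  vanish : ∀ u w′ → M u w′ ℚ.* unit w′ ≡ 0ℚ
  vanish u w′ with w Fin.≟ w′
  ... | no _     = ℚ.*-zeroʳ (M u w′)
  ... | yes refl = trans (ℚ.*-identityʳ (M u w′)) (decidable-stable (M u w′ ℚ.≟ 0ℚ) λ ≢0 → none (u , ≢0))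

argmax : ∀ {n} (a : Fin (suc n) → ℚ) → ∃[ w ] (∀ w′ → a w′ ℚ.≤ a w)
argmax {zero}  a = zero , λ { zero → ℚ.≤-refl }
argmax {suc n} a with argmax (a ∘ suc)
... | w , max with ℚ.≤-total (a zero) (a (suc w))
...   | inj₁ a₀≤ = suc w , λ { zero → a₀≤ ; (suc w′) → max w′ }
...   | inj₂ ≤a₀ = zero , λ { zero → ℚ.≤-refl ; (suc w′) → ℚ.≤-trans (max w′) ≤a₀ }

subtractAt : ∀ {n} → Vector ℚ n → Fin n → ℚ → Vector ℚ n
subtractAt b u x = updateAt b u (ℚ._- x)

sum-subtractAt : ∀ {n} (b : Vector ℚ n) u x → x ℚ.+ sumℚ (subtractAt b u x) ≡ sumℚ b
sum-subtractAt b zero    x = eq x (b zero) (sumℚ (b ∘ suc))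
  where
  eq : ∀ x p q → x ℚ.+ ((p ℚ.- x) ℚ.+ q) ≡ p ℚ.+ q
  eq = solve 3 (λ x p q → x :+ ((p :- x) :+ q) := p :+ q) refl
sum-subtractAt b (suc u) x = trans (eq x (b zero) _) (cong (b zero ℚ.+_) (sum-subtractAt (b ∘ suc) u x))
  where
  eq : ∀ x p q → x ℚ.+ (p ℚ.+ q) ≡ p ℚ.+ (x ℚ.+ q)
  eq = solve 3 (λ x p q → x :+ (p :+ q) := p :+ (x :+ q)) refl

module Elimination {r n} (M : Fin r → Fin (suc n) → ℚ) (u : Fin r) (w : Fin (suc n)) (pivot≢0 : M u w ≢ 0ℚ) where

  pivot⁻¹ : ℚ
  pivot⁻¹ = 1ℚ ÷₀ M u w

  pivot⁻¹*pivot : pivot⁻¹ ℚ.* M u w ≡ 1ℚ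
  pivot⁻¹*pivot = ÷₀-* 1ℚ pivot≢0

  -- The pivot row is not deleted but becomes zero. The row index set stays the same, and what
  -- remains of the pivot row's `b` only has to be nonnegative.
  eliminate : Fin r → Fin n → ℚ
  eliminate u′ j = M u′ (punchIn w j) ℚ.- (M u′ w ℚ.* pivot⁻¹) ℚ.* M u (punchIn w j)

  eliminate-pivot-row : ∀ j → eliminate u j ≡ 0ℚ
  eliminate-pivot-row j = begin
    x ℚ.- (M u w ℚ.* pivot⁻¹) ℚ.* x  ≡⟨ cong (λ z → x ℚ.- z ℚ.* x) (trans (ℚ.*-comm (M u w) pivot⁻¹) pivot⁻¹*pivot) ⟩
    x ℚ.- 1ℚ ℚ.* x                   ≡⟨ solve 1 (λ x → x :- con 1ℚ :* x := con 0ℚ) refl x ⟩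
    0ℚ                               ∎
    where
    open ≡-Reasoning
    x = M u (punchIn w j)

  eliminate-zero : ∀ u′ j → M u′ w ≡ 0ℚ → eliminate u′ j ≡ M u′ (punchIn w j)
  eliminate-zero u′ j z rewrite z = solve 3 (λ x p y → x :- (con 0ℚ :* p) :* y := x) refl (M u′ (punchIn w j)) pivot⁻¹ (M u (punchIn w j))

  -- A kernel vector of the smaller matrix extends to one of `M`: the equation of the pivot row
  -- determines the missing entry `d-w`, and every other row differs from its eliminated form by a
  -- multiple of the pivot row.
  eliminate-kernel : TrivialKernel M → TrivialKernel eliminate
  eliminate-kernel ker d′ elim≡0 j = trans (sym (insertAt-punchIn d′ w d-w j)) (ker d M*d≡0 (punchIn w j))
    where
    open ≡-Reasoning
    s : Fin r → ℚ
    s u′ = sumℚ λ j → M u′ (punchIn w j) ℚ.* d′ j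
    d-w : ℚ
    d-w = ℚ.- (pivot⁻¹ ℚ.* s u)
    d : Fin (suc n) → ℚ
    d = insertAt d′ w d-w

    s-eq : ∀ u′ → s u′ ≡ (M u′ w ℚ.* pivot⁻¹) ℚ.* s u
    s-eq u′ = begin
      s u′                                                                 ≡⟨ sum-cong-≗ (λ j → split (M u′ (punchIn w j)) q (M u (punchIn w j)) (d′ j)) ⟩
      sumℚ (λ j → eliminate u′ j ℚ.* d′ j ℚ.+ q ℚ.* (M u (punchIn w j) ℚ.* d′ j)) ≡⟨ ∑-distrib-+ (λ j → eliminate u′ j ℚ.* d′ j) (λ j → q ℚ.* (M u (punchIn w j) ℚ.* d′ j)) ⟩
      sumℚ (λ j → eliminate u′ j ℚ.* d′ j) ℚ.+ sumℚ (λ j → q ℚ.* (M u (punchIn w j) ℚ.* d′ j))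
        ≡⟨ cong₂ ℚ._+_ (elim≡0 u′) (sym (*-distribˡ-sum q (λ j → M u (punchIn w j) ℚ.* d′ j))) ⟩
      0ℚ ℚ.+ q ℚ.* s u                                                     ≡⟨ ℚ.+-identityˡ (q ℚ.* s u) ⟩
      q ℚ.* s u                                                            ∎
      where
      q = M u′ w ℚ.* pivot⁻¹
      split : ∀ x q y d → x ℚ.* d ≡ (x ℚ.- q ℚ.* y) ℚ.* d ℚ.+ q ℚ.* (y ℚ.* d)
      split = solve 4 (λ x q y d → x :* d := (x :- q :* y) :* d :+ q :* (y :* d)) refl

    M*d≡0 : ∀ u′ → sumℚ (λ w′ → M u′ w′ ℚ.* d w′) ≡ 0ℚ
    M*d≡0 u′ = begin
      sumℚ (λ w′ → M u′ w′ ℚ.* d w′)                                    ≡⟨ sum-remove {i = w} (λ w′ → M u′ w′ ℚ.* d w′) ⟩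
      M u′ w ℚ.* d w ℚ.+ sumℚ (λ j → M u′ (punchIn w j) ℚ.* d (punchIn w j))
        ≡⟨ cong₂ ℚ._+_ (cong (M u′ w ℚ.*_) (insertAt-lookup d′ w d-w))
                       (sum-cong-≗ λ j → cong (M u′ (punchIn w j) ℚ.*_) (insertAt-punchIn d′ w d-w j)) ⟩
      M u′ w ℚ.* d-w ℚ.+ s u′                                           ≡⟨ cong (M u′ w ℚ.* d-w ℚ.+_) (s-eq u′) ⟩
      M u′ w ℚ.* d-w ℚ.+ (M u′ w ℚ.* pivot⁻¹) ℚ.* s u                   ≡⟨ solve 3 (λ m p s → m :* (:- (p :* s)) :+ (m :* p) :* s := con 0ℚ) refl (M u′ w) pivot⁻¹ (s u) ⟩
      0ℚ                                                                ∎

-- Gaussian elimination with the pivot column of maximal weight: a row is only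
-- changed if its entry in that column is nonzero, and then its b bounds all weights left.
weights≤ : ∀ {r n} (M : Fin r → Fin n → ℚ) (a : Fin n → ℚ) (b : Fin r → ℚ) → TrivialKernel M →
           (∀ u → 0ℚ ℚ.≤ b u) → (∀ u w → M u w ≢ 0ℚ → a w ℚ.≤ b u) → sumℚ a ℚ.≤ sumℚ b
weights≤ {n = zero}  M a b ker 0≤b a≤b = sum-nonneg 0≤b
weights≤ {r} {suc n} M a b ker 0≤b a≤b with argmax a
... | w , max with nonzero-column M ker w
...   | u , pivot≢0 = begin
  sumℚ a                        ≡⟨ sum-remove {i = w} a ⟩
  a w ℚ.+ sumℚ (removeAt a w)   ≤⟨ ℚ.+-monoʳ-≤ (a w) (weights≤ eliminate (removeAt a w) b′ (eliminate-kernel ker) 0≤b′ a≤b′) ⟩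
  a w ℚ.+ sumℚ b′               ≡⟨ sum-subtractAt b u (a w) ⟩
  sumℚ b                        ∎
  where
  open ℚ.≤-Reasoning
  open Elimination M u w pivot≢0
  b′ : Fin r → ℚ
  b′ = subtractAt b u (a w)
  0≤b′ : ∀ u′ → 0ℚ ℚ.≤ b′ u′
  0≤b′ u′ with u′ Fin.≟ u
  ... | yes refl = subst (0ℚ ℚ.≤_) (sym (updateAt-updates u b)) (0≤-diff (a≤b u w pivot≢0))
  ... | no u′≢u  = subst (0ℚ ℚ.≤_) (sym (updateAt-minimal u′ u b u′≢u)) (0≤b u′)
  a≤b′ : ∀ u′ j → eliminate u′ j ≢ 0ℚ → a (punchIn w j) ℚ.≤ b′ u′
  a≤b′ u′ j ≢0 with u′ Fin.≟ u
  ... | yes refl = ⊥-elim (≢0 (eliminate-pivot-row j))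
  ... | no u′≢u  = subst (a (punchIn w j) ℚ.≤_) (sym (updateAt-minimal u′ u b u′≢u)) bound
    where
    bound : a (punchIn w j) ℚ.≤ b u′
    bound with M u′ w ℚ.≟ 0ℚ
    ... | yes z = a≤b u′ (punchIn w j) λ M≡0 → ≢0 (trans (eliminate-zero u′ j z) M≡0)
    ... | no ≢0 = ℚ.≤-trans (max (punchIn w j)) (a≤b u′ w ≢0)

-- Extreme points of LP4

-- Coordinates without slack do not move, so `ε` is a minimum of finitely many positive bounds.
-- Using the absolute value of `d` lets the same `ε` serve both directions.
step-size : ∀ {n} (s d : Fin n → ℚ) → (∀ i → 0ℚ ℚ.≤ s i) → (∀ i → s i ≡ 0ℚ → d i ≡ 0ℚ) →
            ∃[ ε ] 0ℚ ℚ.< ε × (∀ i → ε ℚ.* ℚ.∣ d i ∣ ℚ.≤ s i)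
step-size {zero}  s d 0≤s s≡0⇒d≡0 = 1ℚ , 0<1 , λ ()
step-size {suc n} s d 0≤s s≡0⇒d≡0 with step-size (s ∘ suc) (d ∘ suc) (0≤s ∘ suc) (s≡0⇒d≡0 ∘ suc) | s zero ℚ.≟ 0ℚ
... | ε , 0<ε , ε≤ | yes s₀≡0 = ε , 0<ε , λ
  { zero    → ℚ.≤-reflexive (trans (trans (cong (λ z → ε ℚ.* ℚ.∣ z ∣) (s≡0⇒d≡0 zero s₀≡0)) (ℚ.*-zeroʳ ε)) (sym s₀≡0))
  ; (suc i) → ε≤ i }
... | ε , 0<ε , ε≤ | no s₀≢0 = ε₀ ℚ.⊓ ε , ⊓-pos 0<ε₀ 0<ε , λ
  { zero    → ℚ.≤-trans (*-monoʳ (ℚ.0≤∣p∣ (d zero)) (ℚ.p⊓q≤p ε₀ ε)) ε₀≤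
  ; (suc i) → ℚ.≤-trans (*-monoʳ (ℚ.0≤∣p∣ (d (suc i))) (ℚ.p⊓q≤q ε₀ ε)) (ε≤ i) }
  where
  -- Adding 1 keeps the divisor positive when `d zero` vanishes, and only makes the step shorter.
  1+∣d∣ = 1ℚ ℚ.+ ℚ.∣ d zero ∣
  0<1+∣d∣ : 0ℚ ℚ.< 1+∣d∣
  0<1+∣d∣ = ℚ.+-mono-<-≤ 0<1 (ℚ.0≤∣p∣ (d zero))
  ε₀ = s zero ÷₀ 1+∣d∣
  0<ε₀ : 0ℚ ℚ.< ε₀
  0<ε₀ = ÷₀-pos (≤∧≢⇒< (0≤s zero) (≢-sym s₀≢0)) 0<1+∣d∣
  ε₀≤ : ε₀ ℚ.* ℚ.∣ d zero ∣ ℚ.≤ s zero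
  ε₀≤ = subst (ε₀ ℚ.* ℚ.∣ d zero ∣ ℚ.≤_) (÷₀-* (s zero) (≢-sym (ℚ.<⇒≢ 0<1+∣d∣)))
    (*-monoˡ (ℚ.<⇒≤ 0<ε₀) (≤-by 1ℚ (ℚ.<⇒≤ 0<1) (ℚ.+-comm ℚ.∣ d zero ∣ 1ℚ)))

module _ {ε s d : ℚ} (0≤ε : 0ℚ ℚ.≤ ε) (ε∣d∣≤s : ε ℚ.* ℚ.∣ d ∣ ℚ.≤ s) where

  ε*d≤s : ε ℚ.* d ℚ.≤ s
  ε*d≤s = ℚ.≤-trans (*-monoˡ 0≤ε (p≤∣p∣ d)) ε∣d∣≤s

  -ε*d≤s : ε ℚ.* ℚ.- d ℚ.≤ s
  -ε*d≤s = ℚ.≤-trans (*-monoˡ 0≤ε (subst (ℚ.- d ℚ.≤_) (ℚ.∣-p∣≡∣p∣ d) (p≤∣p∣ (ℚ.- d)))) ε∣d∣≤s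

module _ {I : Instance} {x⁰ : Instance.V I → ℚ} {y⁰ : Instance.E I → Instance.V I → ℚ} where
  open Instance I
  open Rounding I x⁰ y⁰

  module _ (s : State) where
    open State s
    open LP4 s

    covered : (V → ℚ) → V → ℚ
    covered z u = ∑∈ W? (λ w → M u w ℚ.* z w)

    module _ {z : V → ℚ} (opt : OptimalExtremePoint z) where
      open OptimalExtremePoint opt
      open Feasible feasible

      -- No constraint that is tight at `z` changes along `d`, so a short step in either direction
      -- stays feasible. Then `z` is the midpoint of two feasible points, which extremality forces
      -- to coincide on `W`.
      extreme-kernel : ∀ (d : V → ℚ) →
        (∀ w → W w → z w ≡ 0ℚ ⊎ z w ≡ 1ℚ → d w ≡ 0ℚ) →
        (∀ u → U u → covered z u ≡ covered x u → covered d u ≡ 0ℚ) →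
        ∀ w → W w → d w ≡ 0ℚ
      extreme-kernel d d-bound d-tight w Ww = begin
        d w                                           ≡⟨ difference (z w) (d w) ε (1ℚ ÷₀ ε) (÷₀-* 1ℚ (≢-sym (ℚ.<⇒≢ 0<ε))) ⟩
        (up w ℚ.- down w) ℚ.* (½ ℚ.* (1ℚ ÷₀ ε))       ≡⟨ cong (λ q → (q ℚ.- down w) ℚ.* (½ ℚ.* (1ℚ ÷₀ ε))) up≡down ⟩
        (down w ℚ.- down w) ℚ.* (½ ℚ.* (1ℚ ÷₀ ε))     ≡⟨ solve 2 (λ p q → (p :- p) :* q := con 0ℚ) refl (down w) (½ ℚ.* (1ℚ ÷₀ ε)) ⟩
        0ℚ                                            ∎
        where
        open ≡-Reasoning
        -- `step-size` for the indices satisfying `P`: elsewhere slack and direction are both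
        -- replaced by 0, which meets its hypotheses trivially.
        room : ∀ {p} {P : Pred V p} (P? : Decidable P) (s d : V → ℚ) →
          (∀ v → P v → 0ℚ ℚ.≤ s v) → (∀ v → P v → s v ≡ 0ℚ → d v ≡ 0ℚ) →
          ∃[ ε ] 0ℚ ℚ.< ε × (∀ v → P v → ε ℚ.* ℚ.∣ d v ∣ ℚ.≤ s v)
        room {P = P} P? s d 0≤s s≡0⇒d≡0 =
          let ε , 0<ε , h = step-size (λ v → if does (P? v) then s v else 0ℚ) (λ v → if does (P? v) then d v else 0ℚ)
                              (λ v → nonneg v (P? v)) (λ v → vanish v (P? v))
          in ε , 0<ε , λ v Pv → subst₂ (λ p q → ε ℚ.* ℚ.∣ p ∣ ℚ.≤ q) (if-yes (P? v) Pv) (if-yes (P? v) Pv) (h v)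
          where
          nonneg : ∀ v (Pv? : Dec (P v)) → 0ℚ ℚ.≤ (if does Pv? then s v else 0ℚ)
          nonneg v (yes Pv) = 0≤s v Pv
          nonneg v (no _)   = ℚ.≤-refl
          vanish : ∀ v (Pv? : Dec (P v)) → (if does Pv? then s v else 0ℚ) ≡ 0ℚ → (if does Pv? then d v else 0ℚ) ≡ 0ℚ
          vanish v (yes Pv) eq = s≡0⇒d≡0 v Pv eq
          vanish v (no _)   eq = refl

        lower = room W? z d z≥0 (λ v Wv z≡0 → d-bound v Wv (inj₁ z≡0))
        upper = room W? (λ v → 1ℚ ℚ.- z v) d (λ v Wv → 0≤-diff (z≤1 v Wv))
                  (λ v Wv 1-z≡0 → d-bound v Wv (inj₂ (sym (diff≡0 1-z≡0))))
        covers = room U? (λ u → covered z u ℚ.- covered x u) (covered d) (λ u Uu → 0≤-diff (cover u Uu))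
                  (λ u Uu eq → d-tight u Uu (diff≡0 eq))

        ε₁ = proj₁ lower
        ε₂ = proj₁ upper
        ε₃ = proj₁ covers
        ε = ε₁ ℚ.⊓ (ε₂ ℚ.⊓ ε₃)
        0<ε : 0ℚ ℚ.< ε
        0<ε = ⊓-pos (proj₁ (proj₂ lower)) (⊓-pos (proj₁ (proj₂ upper)) (proj₁ (proj₂ covers)))
        0≤ε = ℚ.<⇒≤ 0<ε
        ε≤ε₂ : ε ℚ.≤ ε₂
        ε≤ε₂ = ℚ.≤-trans (ℚ.p⊓q≤q ε₁ _) (ℚ.p⊓q≤p ε₂ ε₃)
        ε≤ε₃ : ε ℚ.≤ ε₃
        ε≤ε₃ = ℚ.≤-trans (ℚ.p⊓q≤q ε₁ _) (ℚ.p⊓q≤q ε₂ ε₃)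

        -- The factor 1 gives the perturbed point the shape required by `∑∈-combine`.
        shift : ℚ → V → ℚ
        shift σ v = 1ℚ ℚ.* z v ℚ.+ σ ℚ.* d v
        up   = shift ε
        down = shift (ℚ.- ε)

        -- Abstracts what `ε` and `- ε` have in common, so that feasibility is proved once for both
        -- directions.
        Small : ℚ → Set
        Small σ = ∀ {q s} → ε ℚ.* ℚ.∣ q ∣ ℚ.≤ s → σ ℚ.* q ℚ.≤ s × ℚ.- (σ ℚ.* q) ℚ.≤ s

        small-ε : Small ε
        small-ε {q} h = ε*d≤s 0≤ε h , subst (ℚ._≤ _) (sym (ℚ.neg-distribʳ-* ε q)) (-ε*d≤s 0≤ε h)

        small--ε : Small (ℚ.- ε)
        small--ε {q} h = subst (ℚ._≤ _) (solve 2 (λ e q → e :* (:- q) := (:- e) :* q) refl ε q) (-ε*d≤s 0≤ε h) ,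
                         subst (ℚ._≤ _) (solve 2 (λ e q → e :* q := :- ((:- e) :* q)) refl ε q) (ε*d≤s 0≤ε h)

        shift-feasible : ∀ σ → Small σ → Feasible (shift σ)
        shift-feasible σ small = record
          { cover = λ u Uu → ≤-by _ (0≤-diff (proj₂ (small (ℚ.≤-trans (*-monoʳ (ℚ.0≤∣p∣ (covered d u)) ε≤ε₃) (proj₂ (proj₂ covers) u Uu)))))
              (trans (eq₁ (covered x u) (covered z u) σ (covered d u)) (sym (∑∈-combine W? (M u) z d 1ℚ σ)))
          ; z≥0 = λ v Wv → ≤-by _ (0≤-diff (proj₂ (small (ℚ.≤-trans (*-monoʳ (ℚ.0≤∣p∣ (d v)) (ℚ.p⊓q≤p ε₁ _)) (proj₂ (proj₂ lower) v Wv)))))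
              (eq₂ (z v) σ (d v))
          ; z≤1 = λ v Wv → ≤-by _ (0≤-diff (proj₁ (small (ℚ.≤-trans (*-monoʳ (ℚ.0≤∣p∣ (d v)) ε≤ε₂) (proj₂ (proj₂ upper) v Wv)))))
              (eq₃ (z v) σ (d v))
          }
          where
          eq₁ : ∀ x z σ d → x ℚ.+ ((z ℚ.- x) ℚ.- (ℚ.- (σ ℚ.* d))) ≡ 1ℚ ℚ.* z ℚ.+ σ ℚ.* d
          eq₁ = solve 4 (λ x z σ d → x :+ ((z :- x) :- (:- (σ :* d))) := con 1ℚ :* z :+ σ :* d) refl
          eq₂ : ∀ z σ d → 0ℚ ℚ.+ (z ℚ.- (ℚ.- (σ ℚ.* d))) ≡ 1ℚ ℚ.* z ℚ.+ σ ℚ.* d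
          eq₂ = solve 3 (λ z σ d → con 0ℚ :+ (z :- (:- (σ :* d))) := con 1ℚ :* z :+ σ :* d) refl
          eq₃ : ∀ z σ d → (1ℚ ℚ.* z ℚ.+ σ ℚ.* d) ℚ.+ ((1ℚ ℚ.- z) ℚ.- σ ℚ.* d) ≡ 1ℚ
          eq₃ = solve 3 (λ z σ d → (con 1ℚ :* z :+ σ :* d) :+ ((con 1ℚ :- z) :- σ :* d) := con 1ℚ) refl

        up≡down : up w ≡ down w
        up≡down = extreme up down ½ (shift-feasible ε small-ε) (shift-feasible (ℚ.- ε) small--ε)
          (ℚ.positive⁻¹ ½) ½<1 (λ v _ → midpoint (z v) ε (d v)) w Ww
          where
          midpoint : ∀ z e d → z ≡ (1ℚ ℚ.- ½) ℚ.* (1ℚ ℚ.* z ℚ.+ e ℚ.* d) ℚ.+ ½ ℚ.* (1ℚ ℚ.* z ℚ.+ (ℚ.- e) ℚ.* d)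
          midpoint = solve 3 (λ z e d → z := (con 1ℚ :- con ½) :* (con 1ℚ :* z :+ e :* d) :+ con ½ :* (con 1ℚ :* z :+ (:- e) :* d)) refl

        difference : ∀ z d e e⁻¹ → e⁻¹ ℚ.* e ≡ 1ℚ →
          d ≡ ((1ℚ ℚ.* z ℚ.+ e ℚ.* d) ℚ.- (1ℚ ℚ.* z ℚ.+ (ℚ.- e) ℚ.* d)) ℚ.* (½ ℚ.* e⁻¹)
        difference z d e e⁻¹ eq = trans (trans (sym (ℚ.*-identityˡ d)) (cong (ℚ._* d) (sym eq)))
          (solve 4 (λ z d e i → (i :* e) :* d :=
            ((con 1ℚ :* z :+ e :* d) :- (con 1ℚ :* z :+ (:- e) :* d)) :* (con ½ :* i)) refl z d e e⁻¹)

    module _ {z : V → ℚ} (opt : OptimalExtremePoint z) (a b : V → ℚ)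
             (0≤b : ∀ u → U u → 0ℚ ℚ.≤ b u)
             (a≤b : ∀ u w → U u → W w → M u w ≢ 0ℚ → a w ℚ.≤ b u)
             (a≤0 : ∀ w → W w → z w ≡ 0ℚ ⊎ z w ≡ 1ℚ → a w ℚ.≤ 0ℚ) where
      private
        Tight? : ∀ u → Dec (U u × covered z u ≡ covered x u)
        Tight? u = U? u ×-dec (covered z u ℚ.≟ covered x u)

        Fractional : V → Set
        Fractional w = W w × ¬ (z w ≡ 0ℚ ⊎ z w ≡ 1ℚ)

        Fractional? : Decidable Fractional
        Fractional? w = W? w ×-dec ¬? ((z w ℚ.≟ 0ℚ) ⊎-dec (z w ℚ.≟ 1ℚ))

        -- Constraints that are not tight, and columns outside `W`, are zeroed rather than removed,
        -- so that rows and columns stay indexed by `V`.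
        tightRow : V → V → ℚ
        tightRow u w = if does (Tight? u) then (if does (W? w) then M u w else 0ℚ) else 0ℚ

        -- The vertices outside `W` get a unit row too, as they are columns of the matrix without
        -- being variables of LP4. Unit rows can have bound 0 because the weight at a nonfractional
        -- vertex is at most 0.
        unitRow : V → V → ℚ
        unitRow v w = if does (Fractional? v) then 0ℚ else (if does (v Fin.≟ w) then 1ℚ else 0ℚ)

        rows : Vector (V → ℚ) (#V ℕ.+ #V)
        rows = tightRow ++ unitRow

        aW bU : V → ℚ
        aW w = if does (W? w) then a w else 0ℚ
        bU u = if does (U? u) then b u else 0ℚ

        bounds : Vector ℚ (#V ℕ.+ #V)
        bounds = bU ++ λ (_ : V) → 0ℚ

        rows-kernel : TrivialKernel rows
        rows-kernel d rows*d≡0 v = unless-fractional v (λ (Wv , _) → onW v Wv)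
          where
          open ≡-Reasoning

          tight*d≡0 : ∀ u → sumℚ (λ w → tightRow u w ℚ.* d w) ≡ 0ℚ
          tight*d≡0 u = subst (λ row → sumℚ (λ w → row w ℚ.* d w) ≡ 0ℚ) (lookup-++ˡ tightRow unitRow u) (rows*d≡0 (u ↑ˡ #V))

          unit*d≡0 : ∀ v → sumℚ (λ w → unitRow v w ℚ.* d w) ≡ 0ℚ
          unit*d≡0 v = subst (λ row → sumℚ (λ w → row w ℚ.* d w) ≡ 0ℚ) (lookup-++ʳ tightRow unitRow v) (rows*d≡0 (#V ↑ʳ v))

          unless-fractional : ∀ v → (Fractional v → d v ≡ 0ℚ) → d v ≡ 0ℚ
          unless-fractional v frac⇒ with Fractional? v
          ... | yes frac = frac⇒ frac
          ... | no ¬frac = begin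
            d v                                                          ≡⟨ sum-unit d v ⟨
            sumℚ (λ w → (if does (v Fin.≟ w) then 1ℚ else 0ℚ) ℚ.* d w)   ≡⟨ sum-cong-≗ (λ w → cong (ℚ._* d w) (sym (if-no (Fractional? v) ¬frac))) ⟩
            sumℚ (λ w → unitRow v w ℚ.* d w)                             ≡⟨ unit*d≡0 v ⟩
            0ℚ                                                           ∎

          covered-d≡0 : ∀ u → U u → covered z u ≡ covered x u → covered d u ≡ 0ℚ
          covered-d≡0 u Uu tight = begin
            covered d u                         ≡⟨ sum-cong-≗ (λ w → trans (sym (if-*-comm (does (W? w)) (M u w) (d w)))
                                                       (cong (ℚ._* d w) (sym (if-yes (Tight? u) (Uu , tight))))) ⟩
            sumℚ (λ w → tightRow u w ℚ.* d w)     ≡⟨ tight*d≡0 u ⟩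
            0ℚ                                    ∎

          onW : ∀ w → W w → d w ≡ 0ℚ
          onW = extreme-kernel opt d
            (λ w _ bound → unless-fractional w (λ (_ , ¬bound) → ⊥-elim (¬bound bound))) covered-d≡0

        Bounded : (V → ℚ) → ℚ → Set
        Bounded row q = ∀ w → row w ≢ 0ℚ → aW w ℚ.≤ q

        tight-bounded : ∀ u → Bounded (tightRow u) (bU u)
        tight-bounded u w = go (Tight? u) (W? w)
          where
          go : (t? : Dec (U u × covered z u ≡ covered x u)) (w? : Dec (W w)) →
               (if does t? then (if does w? then M u w else 0ℚ) else 0ℚ) ≢ 0ℚ →
               (if does w? then a w else 0ℚ) ℚ.≤ bU u
          go (no _)         _        ≢0 = ⊥-elim (≢0 refl)
          go (yes _)        (no _)   ≢0 = ⊥-elim (≢0 refl)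
          go (yes (Uu , _)) (yes Ww) ≢0 = subst (a w ℚ.≤_) (sym (if-yes (U? u) Uu)) (a≤b u w Uu Ww ≢0)

        unit-bounded : ∀ v → Bounded (unitRow v) 0ℚ
        unit-bounded v w = go (Fractional? v) (v Fin.≟ w)
          where
          go : (f? : Dec (Fractional v)) (v≟w : Dec (v ≡ w)) →
               (if does f? then 0ℚ else (if does v≟w then 1ℚ else 0ℚ)) ≢ 0ℚ → aW w ℚ.≤ 0ℚ
          go (yes _)    _          ≢0 = ⊥-elim (≢0 refl)
          go (no _)     (no _)     ≢0 = ⊥-elim (≢0 refl)
          go (no ¬frac) (yes refl) ≢0 = if-elim (ℚ._≤ 0ℚ) (W? v)
            (λ Wv → a≤0 v Wv (decidable-stable ((z v ℚ.≟ 0ℚ) ⊎-dec (z v ℚ.≟ 1ℚ)) λ ¬bound → ¬frac (Wv , ¬bound)))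
            (λ _ → ℚ.≤-refl)

      -- The rows are the tight covering constraints and, for each nonfractional
      -- coordinate, a unit vector, which extremality makes a matrix of full column rank.
      ∑W≤∑U : ∑∈ W? a ℚ.≤ ∑∈ U? b
      ∑W≤∑U = begin
        sumℚ aW                             ≤⟨ weights≤ rows aW bounds rows-kernel 0≤bounds
                                                 (++-elim₂ Bounded tightRow unitRow bU (λ _ → 0ℚ) tight-bounded unit-bounded) ⟩
        sumℚ bounds                         ≡⟨ sum-++ bU (λ (_ : V) → 0ℚ) ⟩
        sumℚ bU ℚ.+ sumℚ (λ (_ : V) → 0ℚ)   ≡⟨ cong (sumℚ bU ℚ.+_) (sum-zero {f = λ (_ : V) → 0ℚ} λ _ → refl) ⟩
        sumℚ bU ℚ.+ 0ℚ                      ≡⟨ ℚ.+-identityʳ (sumℚ bU) ⟩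
        sumℚ bU                             ∎
        where
        open ℚ.≤-Reasoning
        0≤bounds : ∀ i → 0ℚ ℚ.≤ bounds i
        0≤bounds = ++-elim₂ (λ (_ : ℚ) q → 0ℚ ℚ.≤ q) bU (λ _ → 0ℚ) bU (λ _ → 0ℚ)
          (λ u → if-elim (0ℚ ℚ.≤_) (U? u) (0≤b u) (λ _ → ℚ.≤-refl)) (λ _ → ℚ.≤-refl)

-- Invariants of the algorithm

module _ (I : Instance) where
  open Instance I

  opposite-joins : ∀ {e v} → v ∈ₑ e → Joins e (opposite e v) v
  opposite-joins {e} {v} v∈e with v Fin.≟ end₁ e | v∈e
  ... | yes v≡₁ | _        = inj₂ (refl , v≡₁)
  ... | no  v≢₁ | inj₁ v≡₁ = ⊥-elim (v≢₁ v≡₁)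
  ... | no  v≢₁ | inj₂ v≡₂ = inj₁ (refl , v≡₂)

  joins-sym : ∀ {e u w} → Joins e u w → Joins e w u
  joins-sym (inj₁ (u≡ , w≡)) = inj₂ (w≡ , u≡)
  joins-sym (inj₂ (u≡ , w≡)) = inj₁ (w≡ , u≡)

  joins⇒∈ : ∀ {e u w} → Joins e u w → u ∈ₑ e
  joins⇒∈ (inj₁ (u≡ , _)) = inj₁ u≡
  joins⇒∈ (inj₂ (u≡ , _)) = inj₂ u≡

  joins⇒opposite : ∀ {e u w} → Joins e u w → opposite e u ≡ w
  joins⇒opposite {e} {u} (inj₁ (u≡ , w≡)) = trans (if-yes (u Fin.≟ end₁ e) u≡) (sym w≡)
  joins⇒opposite {e} {u} (inj₂ (u≡ , w≡)) =
    trans (if-no (u Fin.≟ end₁ e) λ u≡₁ → loopless e (trans (sym u≡₁) u≡)) (sym w≡)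

  joins-sum : ∀ {e u w} (f : V → ℚ) → Joins e u w → f u ℚ.+ f w ≡ f (end₁ e) ℚ.+ f (end₂ e)
  joins-sum f (inj₁ (refl , refl)) = refl
  joins-sum f (inj₂ (refl , refl)) = ℚ.+-comm (f _) (f _)

  module Analysis (x⁰ : V → ℚ) (y⁰ : E → V → ℚ) (lp1 : LP1.Feasible I x⁰ y⁰) where
    open Rounding I x⁰ y⁰
    private module LP1-sol = LP1.Feasible lp1

    U∧W⇒⊥ : ∀ {v} → U v → W v → ⊥
    U∧W⇒⊥ ½≤x (_ , x<½) = ℚ.<-irrefl refl (ℚ.≤-<-trans ½≤x x<½)

    data Kind (v : V) : Set where
      inU    : U v → Kind v
      inW    : W v → Kind v
      isZero : x⁰ v ≡ 0ℚ → Kind v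

    kind : ∀ v → Kind v
    kind v with U? v | W? v
    ... | yes Uv | _      = inU Uv
    ... | no _   | yes Wv = inW Wv
    ... | no ¬Uv | no ¬Wv = isZero (ℚ.≤-antisym (ℚ.≮⇒≥ λ 0<x → ¬Wv (0<x , ℚ.≰⇒> ¬Uv)) (LP1-sol.x≥0 v))

    zero⇒¬U : ∀ {v} → x⁰ v ≡ 0ℚ → ¬ U v
    zero⇒¬U {v} eq Uv = ℚ.<-irrefl refl (ℚ.<-≤-trans (ℚ.positive⁻¹ ½) (subst (½ ℚ.≤_) eq Uv))

    zero⇒¬W : ∀ {v} → x⁰ v ≡ 0ℚ → ¬ W v
    zero⇒¬W eq (0<x , _) = ℚ.<⇒≢ 0<x (sym eq)

    0<x⁰ : ∀ {u} → U u → 0ℚ ℚ.< x⁰ u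
    0<x⁰ Uu = ℚ.<-≤-trans (ℚ.positive⁻¹ ½) Uu

    x⁰≢0 : ∀ {v} → 0ℚ ℚ.< x⁰ v → x⁰ v ≢ 0ℚ
    x⁰≢0 0<x = ≢-sym (ℚ.<⇒≢ 0<x)

    ratio-* : ∀ e {w} → W w → ratio e w ℚ.* x⁰ w ≡ y⁰ e w
    ratio-* e {w} (0<x , _) = ÷₀-* (y⁰ e w) (x⁰≢0 0<x)

    ratio≥0 : ∀ {e w} → w ∈ₑ e → W w → 0ℚ ℚ.≤ ratio e w
    ratio≥0 {e} {w} w∈e Ww = *-cancelʳ (proj₁ Ww)
      (subst₂ ℚ._≤_ (sym (ℚ.*-zeroˡ (x⁰ w))) (sym (ratio-* e Ww)) (LP1-sol.y≥0 e w w∈e))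

    ratio≤1 : ∀ {e w} → w ∈ₑ e → W w → ratio e w ℚ.≤ 1ℚ
    ratio≤1 {e} {w} w∈e Ww = *-cancelʳ (proj₁ Ww)
      (subst₂ ℚ._≤_ (sym (ratio-* e Ww)) (sym (ℚ.*-identityˡ (x⁰ w))) (LP1-sol.y≤x e w w∈e))

    -- As y⁰ e w ≤ x⁰ w < ½, the other endpoint u has x⁰ u ≥ y⁰ e u > ½.
    W-opposite-U : ∀ {e u w} → Joins e u w → W w → U u
    W-opposite-U {e} {u} {w} joins (_ , x<½) = ℚ.≤-trans
      (ℚ.≮⇒≥ λ y<½ → ℚ.<-irrefl sum≡1 (ℚ.+-mono-< y<½ (ℚ.≤-<-trans (LP1-sol.y≤x e w (joins⇒∈ (joins-sym joins))) x<½)))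
      (LP1-sol.y≤x e u (joins⇒∈ joins))
      where
      sum≡1 : y⁰ e u ℚ.+ y⁰ e w ≡ ½ ℚ.+ ½
      sum≡1 = trans (joins-sum (y⁰ e) joins) (LP1-sol.assigned e)

    -- `U-load` also counts the edges in `T`, at the fractional values frozen when they were added;
    -- `via` records that scaling by the boost lifts those values to at least 1. Boosts are taken at
    -- `x⁰`, which `x` never leaves outside `W`. The loads on `W` need no field of their own, being
    -- controlled by `y-ratio`.
    record Invariant (s : State) : Set where
      open State s
      field
        x-fixed    : ∀ v → ¬ W v → x v ≡ x⁰ v
        x≥0        : ∀ w → W w → 0ℚ ℚ.≤ x w
        x≤1        : ∀ w → W w → x w ℚ.≤ 1ℚ
        y-assigned : ∀ e → y e (end₁ e) ℚ.+ y e (end₂ e) ≡ 1ℚ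
        y≥0        : ∀ e v → v ∈ₑ e → 0ℚ ℚ.≤ y e v
        y-ratio    : ∀ e u w → Moving T e u w → y e w ≡ ratio e w ℚ.* x w
        y-zero     : ∀ e v → v ∈ₑ e → x⁰ v ≡ 0ℚ → y e v ≡ 0ℚ
        U-load     : ∀ u → U u → ∑∈ (u ∈ₑ?_) (λ e → y e u) ℚ.≤ fromℤ (+ k u) ℚ.* x⁰ u
        via        : ∀ e u → T e ≡ just u → U u × u ∈ₑ e × 1ℚ ℚ.≤ y e u ℚ.* boost x⁰ u
        ∑x≤∑x⁰     : sumℚ x ℚ.≤ sumℚ x⁰

      y-partner : ∀ e u w → Moving T e u w → y e u ≡ 1ℚ ℚ.- ratio e w ℚ.* x w
      y-partner e u w mv@(_ , joins , _) = begin
        y e u                         ≡⟨ solve 2 (λ p q → p := p :+ q :- q) refl (y e u) (y e w) ⟩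
        y e u ℚ.+ y e w ℚ.- y e w     ≡⟨ cong₂ ℚ._-_ (trans (joins-sum (y e) joins) (y-assigned e)) (y-ratio e u w mv) ⟩
        1ℚ ℚ.- ratio e w ℚ.* x w      ∎
        where open ≡-Reasoning

    -- Kept apart from `Invariant` because it may fail at the start and is only established once
    -- step 2 has been exhausted.
    Calm : State → Set
    Calm (state x y T) = ∀ e u w → Moving T e u w → y e u ℚ.* boost x⁰ u ℚ.≤ 1ℚ

    initial-invariant : Invariant initial
    initial-invariant = record
      { x-fixed    = λ _ _ → refl
      ; x≥0        = λ w _ → LP1-sol.x≥0 w
      ; x≤1        = λ w Ww → ℚ.<⇒≤ (ℚ.<-trans (proj₂ Ww) ½<1)
      ; y-assigned = LP1-sol.assigned
      ; y≥0        = LP1-sol.y≥0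
      ; y-ratio    = λ e u w (_ , _ , _ , Ww) → sym (ratio-* e Ww)
      ; y-zero     = λ e v v∈e eq → ℚ.≤-antisym (subst (y⁰ e v ℚ.≤_) eq (LP1-sol.y≤x e v v∈e)) (LP1-sol.y≥0 e v v∈e)
      ; U-load     = λ u _ → LP1-sol.capacity u
      ; via        = λ _ _ ()
      ; ∑x≤∑x⁰     = ℚ.≤-refl
      }

    addVia-∉ : ∀ e u T e′ → e′ ∉ addVia e u T → e′ ∉ T
    addVia-∉ e u T e′ e′∉ with e′ Fin.≟ e
    ... | no e′≢e = trans (sym (updateAt-minimal e′ e T e′≢e)) e′∉
    ... | yes refl with () ← trans (sym (updateAt-updates e T)) e′∉

    addVia-moving : ∀ e u T {e′ u′ w′} → Moving (addVia e u T) e′ u′ w′ → Moving T e′ u′ w′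
    addVia-moving e u T {e′} (e′∉ , rest) = addVia-∉ e u T e′ e′∉ , rest

    addVia-invariant : ∀ {x y T} e u → U u → u ∈ₑ e → 1ℚ ℚ.≤ y e u ℚ.* boost x⁰ u →
                       Invariant (state x y T) → Invariant (state x y (addVia e u T))
    addVia-invariant {x} {y} {T} e u Uu u∈e 1≤ inv = record
      { Invariant inv
      ; y-ratio = λ e′ u′ w′ mv → Invariant.y-ratio inv e′ u′ w′ (addVia-moving e u T mv)
      ; via     = via′
      }
      where
      via′ : ∀ e′ u′ → addVia e u T e′ ≡ just u′ → U u′ × u′ ∈ₑ e′ × 1ℚ ℚ.≤ y e′ u′ ℚ.* boost x⁰ u′
      via′ e′ u′ eq with e′ Fin.≟ e
      ... | no e′≢e = Invariant.via inv e′ u′ (trans (sym (updateAt-minimal e′ e T e′≢e)) eq)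
      ... | yes refl with refl ← just-injective (trans (sym (updateAt-updates e T)) eq) = Uu , u∈e , 1≤

    boost-fixed : ∀ (x : V → ℚ) {u} → x u ≡ x⁰ u → boost x u ≡ boost x⁰ u
    boost-fixed x = cong λ q → fromℤ (ℚ.ceiling q) ÷₀ q

    step2-invariant : ∀ {s s′} → s ⟶ s′ → Invariant s → Invariant s′
    step2-invariant (add {x} {y} e u (Uu , u∈e , _ , 1≤)) inv = addVia-invariant e u Uu u∈e
      (subst (λ β → 1ℚ ℚ.≤ y e u ℚ.* β) (boost-fixed x (Invariant.x-fixed inv u (U∧W⇒⊥ Uu))) 1≤) inv

    step2-calm : ∀ {s} → Invariant s → (∀ e u → ¬ Addable s e u) → Calm s
    step2-calm {state x y T} inv none e u w (e∉T , joins , Uu , _) = ℚ.<⇒≤ (ℚ.≰⇒> λ 1≤ →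
      none e u (Uu , joins⇒∈ joins , e∉T ,
        subst (λ β → 1ℚ ℚ.≤ y e u ℚ.* β) (sym (boost-fixed x (Invariant.x-fixed inv u (U∧W⇒⊥ Uu)))) 1≤))

    -- The motion towards the LP4 solution

    module _ (s : State) (inv : Invariant s) (xnew : V → ℚ) (target : LP4.Target s xnew) where
      open State s
      open Invariant inv
      open LP4 s
      open Target target
      open OptimalExtremePoint optimal
      open Feasible feasible

      module _ (t : ℚ) where
        private
          x′ = xᵗ s xnew t
          y′ = yᵗ s xnew t

        yᵗ-W : ∀ {e u w} → Moving T e u w → y′ e w ≡ ratio e w ℚ.* x′ w
        yᵗ-W {e} {u} {w} mv@(_ , joins , _) = if-yes (moving? T e (opposite e w) w)
          (subst (λ u → Moving T e u w) (sym (joins⇒opposite (joins-sym joins))) mv)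

        yᵗ-U : ∀ {e u w} → Moving T e u w → y′ e u ≡ 1ℚ ℚ.- ratio e w ℚ.* x′ w
        yᵗ-U {e} {u} {w} mv@(_ , joins , Uu , _) = trans
          (if-no (moving? T e (opposite e u) u) λ (_ , _ , _ , Wu) → U∧W⇒⊥ Uu Wu)
          (trans (if-yes (moving? T e u (opposite e u)) (subst (Moving T e u) (sym opp) mv))
                 (cong (λ w → 1ℚ ℚ.- ratio e w ℚ.* x′ w) opp))
          where opp = joins⇒opposite joins

        yᵗ-still : ∀ {e v} → (∀ u → ¬ Moving T e u v) → (∀ w → ¬ Moving T e v w) → y′ e v ≡ y e v
        yᵗ-still {e} {v} ¬mvW ¬mvU = trans (if-no (moving? T e (opposite e v) v) (¬mvW _))
                                           (if-no (moving? T e v (opposite e v)) (¬mvU _))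

        xᵗ-fixed : ∀ v → ¬ W v → x′ v ≡ x v
        xᵗ-fixed v ¬Wv = trans (cong (combination t (x v)) (fixed v ¬Wv)) (combination-same t (x v))

        -- For u ∈ U every edge keeps y e u plus the weight it shifts to W constant along a
        -- step, so the load of u drops by exactly as much as its coverage in LP4 grows.
        shifted : (V → ℚ) → (E → V → ℚ) → V → E → ℚ
        shifted x y u e = (if does (u ∈ₑ? e) then y e u else 0ℚ) ℚ.+ crossing-weight
          where crossing-weight = ∑∈ W? λ w → (if does (joins? e u w ×-dec (e ∉? T)) then ratio e w else 0ℚ) ℚ.* x w

        ∑-shifted : ∀ x y u → sumℚ (shifted x y u) ≡ ∑∈ (u ∈ₑ?_) (λ e → y e u) ℚ.+ covered s x u
        ∑-shifted x y u = trans (∑-distrib-+ (λ e → if does (u ∈ₑ? e) then y e u else 0ℚ) (λ e → sumℚ (f e)))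
          (cong (∑∈ (u ∈ₑ?_) (λ e → y e u) ℚ.+_) (trans (∑-comm f) (sum-cong-≗ column)))
          where
          g : E → V → ℚ
          g e w = if does (joins? e u w ×-dec (e ∉? T)) then ratio e w else 0ℚ
          f : E → V → ℚ
          f e w = if does (W? w) then g e w ℚ.* x w else 0ℚ
          column : ∀ w → sumℚ (λ e → f e w) ≡ (if does (W? w) then M u w ℚ.* x w else 0ℚ)
          column w with does (W? w)
          ... | false = sum-zero {f = λ (_ : E) → 0ℚ} λ _ → refl
          ... | true  = begin
            sumℚ (λ e → g e w ℚ.* x w)   ≡⟨ sum-cong-≗ (λ e → ℚ.*-comm (g e w) (x w)) ⟩
            sumℚ (λ e → x w ℚ.* g e w)   ≡⟨ *-distribˡ-sum (x w) (λ e → g e w) ⟨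
            x w ℚ.* M u w                ≡⟨ ℚ.*-comm (x w) (M u w) ⟩
            M u w ℚ.* x w                ∎
            where open ≡-Reasoning

        shifted-moving : ∀ x y {u e w} → Moving T e u w → y e u ≡ 1ℚ ℚ.- ratio e w ℚ.* x w → shifted x y u e ≡ 1ℚ
        shifted-moving x y {u} {e} {w} mv@(e∉T , joins , Uu , Ww) eq = begin
          shifted x y u e                                               ≡⟨ cong₂ ℚ._+_ (trans (if-yes (u ∈ₑ? e) (joins⇒∈ joins)) eq) only-w ⟩
          1ℚ ℚ.- ratio e w ℚ.* x w ℚ.+ ratio e w ℚ.* x w                ≡⟨ solve 1 (λ r → con 1ℚ :- r :+ r := con 1ℚ) refl (ratio e w ℚ.* x w) ⟩
          1ℚ                                                            ∎
          where
          open ≡-Reasoning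
          -- The other endpoint of `e` is unique, so `w` is the only vertex of `W` that contributes.
          only-w = trans
            (sum-single _ w λ w′ w′≢w → if-elim (_≡ 0ℚ) (W? w′)
              (λ Ww′ → trans (cong (ℚ._* x w′) (if-no (joins? e u w′ ×-dec (e ∉? T))
                λ (joins′ , _) → w′≢w (trans (sym (joins⇒opposite joins′)) (joins⇒opposite joins))))
                (ℚ.*-zeroˡ (x w′)))
              (λ _ → refl))
            (trans (if-yes (W? w) Ww) (cong (ℚ._* x w) (if-yes (joins? e u w ×-dec (e ∉? T)) (joins , e∉T))))

        shifted-still : ∀ x y {u e} → U u → (∀ w → ¬ Moving T e u w) →
                        shifted x y u e ≡ (if does (u ∈ₑ? e) then y e u else 0ℚ) ℚ.+ 0ℚ
        shifted-still x y {u} {e} Uu ¬mv = cong ((if does (u ∈ₑ? e) then y e u else 0ℚ) ℚ.+_)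
          (sum-zero λ w → if-elim (_≡ 0ℚ) (W? w)
            (λ Ww → trans (cong (ℚ._* x w) (if-no (joins? e u w ×-dec (e ∉? T)) λ (joins , e∉T) → ¬mv w (e∉T , joins , Uu , Ww)))
                          (ℚ.*-zeroˡ (x w)))
            (λ _ → refl))

        shifted-constant : ∀ u → U u → ∀ e → shifted x′ y′ u e ≡ shifted x y u e
        shifted-constant u Uu e with Fin.any? (λ w → moving? T e u w)
        ... | yes (w , mv) = trans (shifted-moving x′ y′ mv (yᵗ-U mv)) (sym (shifted-moving x y mv (y-partner e u w mv)))
        ... | no none = trans (shifted-still x′ y′ Uu ¬mv) (trans
            (cong (λ q → (if does (u ∈ₑ? e) then q else 0ℚ) ℚ.+ 0ℚ) (yᵗ-still (λ _ (_ , _ , _ , Wu) → U∧W⇒⊥ Uu Wu) ¬mv))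
            (sym (shifted-still x y Uu ¬mv)))
          where
          ¬mv : ∀ w → ¬ Moving T e u w
          ¬mv w mv = none (w , mv)

        module _ (0≤t : 0ℚ ℚ.≤ t) (t≤1 : t ℚ.≤ 1ℚ) where

          covered-increases : ∀ u → U u → covered s x u ℚ.≤ covered s x′ u
          covered-increases u Uu = subst (covered s x u ℚ.≤_) (sym (∑∈-combine W? (M u) x xnew (1ℚ ℚ.- t) t))
            (combination-≥ 0≤t t≤1 ℚ.≤-refl (cover u Uu))

          load-decreases : ∀ u → U u → ∑∈ (u ∈ₑ?_) (λ e → y′ e u) ℚ.≤ ∑∈ (u ∈ₑ?_) (λ e → y e u)
          load-decreases u Uu = ≤-by (covered s x′ u ℚ.- covered s x u) (0≤-diff (covered-increases u Uu)) (begin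
            l′ ℚ.+ (c′ ℚ.- c)                ≡⟨ ℚ.+-assoc l′ c′ (ℚ.- c) ⟨
            l′ ℚ.+ c′ ℚ.- c                  ≡⟨ cong (ℚ._- c) (∑-shifted x′ y′ u) ⟨
            sumℚ (shifted x′ y′ u) ℚ.- c     ≡⟨ cong (ℚ._- c) (sum-cong-≗ (shifted-constant u Uu)) ⟩
            sumℚ (shifted x y u) ℚ.- c       ≡⟨ cong (ℚ._- c) (∑-shifted x y u) ⟩
            l ℚ.+ c ℚ.- c                    ≡⟨ solve 2 (λ l c → l :+ c :- c := l) refl l c ⟩
            l                                ∎)
            where
            open ≡-Reasoning
            l′ = ∑∈ (u ∈ₑ?_) (λ e → y′ e u)
            l  = ∑∈ (u ∈ₑ?_) (λ e → y e u)
            c′ = covered s x′ u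
            c  = covered s x u

          -- The right sides of the covering constraints are the coverages of the current `x`, so
          -- `x` itself competes in LP4.
          ∑xnew≤∑x : sumℚ xnew ℚ.≤ sumℚ x
          ∑xnew≤∑x = subst₂ ℚ._≤_ (sym (split xnew)) (sym (split x))
            (ℚ.+-mono-≤ (minimal x record { cover = λ _ _ → ℚ.≤-refl ; z≥0 = x≥0 ; z≤1 = x≤1 })
                        (ℚ.≤-reflexive (sum-cong-≗ λ v → off-W v (W? v))))
            where
            off-W : ∀ v (d : Dec (W v)) → (if does d then 0ℚ else xnew v) ≡ (if does d then 0ℚ else x v)
            off-W v (yes _)  = refl
            off-W v (no ¬Wv) = fixed v ¬Wv
            split : ∀ f → sumℚ f ≡ ∑∈ W? f ℚ.+ sumℚ (λ v → if does (W? v) then 0ℚ else f v)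
            split f = trans (sum-cong-≗ λ v → either v (does (W? v)))
              (∑-distrib-+ (λ v → if does (W? v) then f v else 0ℚ) (λ v → if does (W? v) then 0ℚ else f v))
              where
              either : ∀ v b → f v ≡ (if b then f v else 0ℚ) ℚ.+ (if b then 0ℚ else f v)
              either v true  = sym (ℚ.+-identityʳ (f v))
              either v false = sym (ℚ.+-identityˡ (f v))

          ∑xᵗ≤∑x : sumℚ x′ ℚ.≤ sumℚ x
          ∑xᵗ≤∑x = subst (ℚ._≤ sumℚ x) (sym ∑xᵗ) (combination-≤ 0≤t t≤1 ℚ.≤-refl ∑xnew≤∑x)
            where
            ∑xᵗ : sumℚ x′ ≡ combination t (sumℚ x) (sumℚ xnew)
            ∑xᵗ = trans (∑-distrib-+ (λ v → (1ℚ ℚ.- t) ℚ.* x v) (λ v → t ℚ.* xnew v))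
              (sym (cong₂ ℚ._+_ (*-distribˡ-sum (1ℚ ℚ.- t) x) (*-distribˡ-sum t xnew)))

          x′≥0 : ∀ w → W w → 0ℚ ℚ.≤ x′ w
          x′≥0 w Ww = combination-≥ 0≤t t≤1 (x≥0 w Ww) (z≥0 w Ww)

          x′≤1 : ∀ w → W w → x′ w ℚ.≤ 1ℚ
          x′≤1 w Ww = combination-≤ 0≤t t≤1 (x≤1 w Ww) (z≤1 w Ww)

          advance-invariant : Invariant (state x′ y′ T)
          advance-invariant = record
            { x-fixed    = λ v ¬Wv → trans (xᵗ-fixed v ¬Wv) (x-fixed v ¬Wv)
            ; x≥0        = x′≥0
            ; x≤1        = x′≤1
            ; y-assigned = assigned′
            ; y≥0        = y′≥0
            ; y-ratio    = λ e u w mv → yᵗ-W mv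
            ; y-zero     = λ e v v∈e x⁰≡0 → trans
                (yᵗ-still (λ _ (_ , _ , _ , Wv) → zero⇒¬W x⁰≡0 Wv) (λ _ (_ , _ , Uv , _) → zero⇒¬U x⁰≡0 Uv))
                (y-zero e v v∈e x⁰≡0)
            ; U-load     = λ u Uu → ℚ.≤-trans (load-decreases u Uu) (U-load u Uu)
            ; via        = λ e u Te≡u → let Uu , u∈e , 1≤ = via e u Te≡u in Uu , u∈e ,
                subst (λ q → 1ℚ ℚ.≤ q ℚ.* boost x⁰ u) (sym (in-T-still Te≡u)) 1≤
            ; ∑x≤∑x⁰     = ℚ.≤-trans ∑xᵗ≤∑x ∑x≤∑x⁰
            }
            where
            in-T-still : ∀ {e u v} → T e ≡ just u → y′ e v ≡ y e v
            in-T-still Te≡u = yᵗ-still (λ _ (e∉T , _) → contra Te≡u e∉T) (λ _ (e∉T , _) → contra Te≡u e∉T)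
              where
              contra : ∀ {e u} → T e ≡ just u → T e ≡ nothing → ⊥
              contra p q with () ← trans (sym p) q

            assigned′ : ∀ e → y′ e (end₁ e) ℚ.+ y′ e (end₂ e) ≡ 1ℚ
            assigned′ e with Fin.any? (λ u → Fin.any? (λ w → moving? T e u w))
            ... | yes (u , w , mv@(_ , joins , _)) = begin
              y′ e (end₁ e) ℚ.+ y′ e (end₂ e)                     ≡⟨ joins-sum (y′ e) joins ⟨
              y′ e u ℚ.+ y′ e w                                   ≡⟨ cong₂ ℚ._+_ (yᵗ-U mv) (yᵗ-W mv) ⟩
              1ℚ ℚ.- ratio e w ℚ.* x′ w ℚ.+ ratio e w ℚ.* x′ w    ≡⟨ solve 1 (λ r → con 1ℚ :- r :+ r := con 1ℚ) refl (ratio e w ℚ.* x′ w) ⟩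
              1ℚ                                                  ∎
              where open ≡-Reasoning
            ... | no none = trans (cong₂ ℚ._+_ (still (end₁ e)) (still (end₂ e))) (y-assigned e)
              where
              still : ∀ v → y′ e v ≡ y e v
              still v = yᵗ-still (λ u mv → none (u , v , mv)) (λ w mv → none (v , w , mv))

            y′≥0 : ∀ e v → v ∈ₑ e → 0ℚ ℚ.≤ y′ e v
            y′≥0 e v v∈e with Fin.any? (λ u → moving? T e u v) | Fin.any? (λ w → moving? T e v w)
            ... | yes (u , mv@(_ , _ , _ , Wv)) | _ =
              subst (0ℚ ℚ.≤_) (sym (yᵗ-W mv)) (0≤* (ratio≥0 v∈e Wv) (x′≥0 v Wv))
            -- The end in `U` keeps `1 - ratio e w * x′ w`, which is nonnegative because LP1 bounds
            -- the ratio by 1 and LP4 bounds `x′ w` by 1.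
            ... | no _ | yes (w , mv@(_ , joins , _ , Ww)) =
              subst (0ℚ ℚ.≤_) (sym (yᵗ-U mv)) (0≤-diff (ℚ.≤-trans
                (*-monoʳ (x′≥0 w Ww) (ratio≤1 (joins⇒∈ (joins-sym joins)) Ww))
                (subst (ℚ._≤ 1ℚ) (sym (ℚ.*-identityˡ (x′ w))) (x′≤1 w Ww))))
            ... | no ¬mvW | no ¬mvU = subst (0ℚ ℚ.≤_)
              (sym (yᵗ-still (λ u mv → ¬mvW (u , mv)) (λ w mv → ¬mvU (w , mv)))) (y≥0 e v v∈e)

      -- The scaled value of an edge is affine in `t` and starts at no more than 1; if it exceeded 1
      -- at `t`, it would have equalled 1 strictly earlier, which is an excluded hit. Equality at
      -- `t` is allowed, since several edges may reach 1 together.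
      advance-calm : Calm s → ∀ t → 0ℚ ℚ.≤ t →
                     (∀ t′ e u → 0ℚ ℚ.≤ t′ → t′ ℚ.< t → ¬ Hit s xnew t′ e u) →
                     Calm (state (xᵗ s xnew t) (yᵗ s xnew t) T)
      advance-calm calm t 0≤t no-hit e u w mv@(_ , _ , Uu , _) = ℚ.≮⇒≥ λ 1< →
        let t′ , 0≤t′ , t′<t , value = crossing (y e u ℚ.* β) γ 0≤t (calm e u w mv) (subst (1ℚ ℚ.<_) (affine t) 1<)
        in no-hit t′ e u 0≤t′ t′<t (w , mv ,
             trans (cong (yᵗ s xnew t′ e u ℚ.*_) (boost-fixed x (x-fixed u (U∧W⇒⊥ Uu)))) (trans (affine t′) value))
        where
        β = boost x⁰ u
        r = ratio e w
        γ = r ℚ.* (x w ℚ.- xnew w) ℚ.* β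
        affine : ∀ t → yᵗ s xnew t e u ℚ.* β ≡ y e u ℚ.* β ℚ.+ t ℚ.* γ
        affine t = begin
          yᵗ s xnew t e u ℚ.* β                                     ≡⟨ cong (ℚ._* β) (yᵗ-U t mv) ⟩
          (1ℚ ℚ.- r ℚ.* combination t (x w) (xnew w)) ℚ.* β         ≡⟨ expand r t (x w) (xnew w) β ⟩
          (1ℚ ℚ.- r ℚ.* x w) ℚ.* β ℚ.+ t ℚ.* γ                      ≡⟨ cong (λ q → q ℚ.* β ℚ.+ t ℚ.* γ) (y-partner e u w mv) ⟨
          y e u ℚ.* β ℚ.+ t ℚ.* γ                                   ∎
          where
          open ≡-Reasoning
          expand : ∀ r t x x′ β → (1ℚ ℚ.- r ℚ.* combination t x x′) ℚ.* β ≡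
                   (1ℚ ℚ.- r ℚ.* x) ℚ.* β ℚ.+ t ℚ.* (r ℚ.* (x ℚ.- x′) ℚ.* β)
          expand = solve 5 (λ r t x x′ β → (con 1ℚ :- r :* ((con 1ℚ :- t) :* x :+ t :* x′)) :* β :=
                   (con 1ℚ :- r :* x) :* β :+ t :* (r :* (x :- x′) :* β)) refl

    -- The cost of rounding

    boost-* : ∀ {u} → U u → boost x⁰ u ℚ.* x⁰ u ≡ ⌈ x⁰ u ⌉ᵠ
    boost-* Uu = ÷₀-* _ (x⁰≢0 (0<x⁰ Uu))

    1≤boost : ∀ {u} → U u → 1ℚ ℚ.≤ boost x⁰ u
    1≤boost {u} Uu = *-cancelʳ (0<x⁰ Uu)
      (subst₂ ℚ._≤_ (sym (ℚ.*-identityˡ (x⁰ u))) (sym (boost-* Uu)) (p≤⌈p⌉ (x⁰ u)))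

    boost≥0 : ∀ {u} → U u → 0ℚ ℚ.≤ boost x⁰ u
    boost≥0 Uu = ℚ.≤-trans 0≤1 (1≤boost Uu)

    module _ (s : State) (inv : Invariant s) (calm : Calm s) where
      open State s
      open Invariant inv
      open LP4 s

      M≢0⇒moving : ∀ u w → U u → W w → M u w ≢ 0ℚ → ∃[ e ] Moving T e u w
      M≢0⇒moving u w Uu Ww M≢0 with Fin.any? (λ e → moving? T e u w)
      ... | yes e,mv = e,mv
      ... | no none  = ⊥-elim (M≢0 (sum-zero λ e → if-no (joins? e u w ×-dec (e ∉? T))
                         λ (joins , e∉T) → none (e , e∉T , joins , Uu , Ww)))

      -- Calmness gives (1 - x w) ⌈ x u ⌉ ≤ x u, whence
      -- (2 x u - ⌈ x u ⌉) - (1 - 2 x w) = 2 (x u - (1 - x w) ⌈ x u ⌉) + (⌈ x u ⌉ - 1) (1 - 2 x w).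
      charge : ∀ u w → U u → W w → M u w ≢ 0ℚ →
               ⌈ x w ⌉ᵠ ℚ.- (x w ℚ.+ x w) ℚ.≤ (x⁰ u ℚ.+ x⁰ u) ℚ.- ⌈ x⁰ u ⌉ᵠ
      charge u w Uu Ww M≢0 with M≢0⇒moving u w Uu Ww M≢0
      ... | e , mv@(_ , joins , _) = ℚ.≤-trans (ℚ.+-monoˡ-≤ (ℚ.- (p ℚ.+ p)) (fromℤ-mono-≤ (ceiling-least {x w} {1ℤ} (x≤1 w Ww)))) bound
        where
        p = x w
        q = x⁰ u
        c = ⌈ q ⌉ᵠ
        β = boost x⁰ u
        1-p≤y : 1ℚ ℚ.- p ℚ.≤ y e u
        1-p≤y = subst (1ℚ ℚ.- p ℚ.≤_) (sym (y-partner e u w mv)) (ℚ.+-monoʳ-≤ 1ℚ (ℚ.neg-antimono-≤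
          (subst (ratio e w ℚ.* p ℚ.≤_) (ℚ.*-identityˡ p) (*-monoʳ (x≥0 w Ww) (ratio≤1 (joins⇒∈ (joins-sym joins)) Ww)))))
        [1-p]c≤q : (1ℚ ℚ.- p) ℚ.* c ℚ.≤ q
        [1-p]c≤q = begin
          (1ℚ ℚ.- p) ℚ.* c              ≡⟨ cong ((1ℚ ℚ.- p) ℚ.*_) (boost-* Uu) ⟨
          (1ℚ ℚ.- p) ℚ.* (β ℚ.* q)      ≡⟨ ℚ.*-assoc (1ℚ ℚ.- p) β q ⟨
          (1ℚ ℚ.- p) ℚ.* β ℚ.* q        ≤⟨ *-monoʳ (ℚ.<⇒≤ (0<x⁰ Uu)) (*-monoʳ (boost≥0 Uu) 1-p≤y) ⟩
          y e u ℚ.* β ℚ.* q             ≤⟨ *-monoʳ (ℚ.<⇒≤ (0<x⁰ Uu)) (calm e u w mv) ⟩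
          1ℚ ℚ.* q                      ≡⟨ ℚ.*-identityˡ q ⟩
          q                             ∎
          where open ℚ.≤-Reasoning
        bound : 1ℚ ℚ.- (p ℚ.+ p) ℚ.≤ (q ℚ.+ q) ℚ.- c
        bound with ℚ.≤-total (p ℚ.+ p) 1ℚ
        ... | inj₁ 2p≤1 = ≤-by _ (0≤+ (0≤+ (0≤-diff [1-p]c≤q) (0≤-diff [1-p]c≤q)) (0≤* (0≤-diff (1≤⌈⌉ (0<x⁰ Uu))) (0≤-diff 2p≤1)))
          (solve 3 (λ p q c → con 1ℚ :- (p :+ p) :+ ((q :- (con 1ℚ :- p) :* c) :+ (q :- (con 1ℚ :- p) :* c)
             :+ (c :- con 1ℚ) :* (con 1ℚ :- (p :+ p))) := (q :+ q) :- c) refl p q c)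
        -- Here the product in the identity may be negative, but the left side is at most 0 and the
        -- slack of `u` at least 0.
        ... | inj₂ 1≤2p = ≤-by _ (0≤+ (0≤-diff 1≤2p) (0≤-diff (⌈⌉≤double Uu)))
          (solve 3 (λ p q c → con 1ℚ :- (p :+ p) :+ (((p :+ p) :- con 1ℚ) :+ ((q :+ q) :- c)) := (q :+ q) :- c) refl p q c)

    module _ {s : State} {z : V → ℚ} (opt : LP4.OptimalExtremePoint s z) (y : E → V → ℚ)
             (inv : Invariant (state z y (State.T s))) (calm : Calm (state z y (State.T s))) where
      open Invariant inv
      private
        a b c : V → ℚ
        c v = ⌈ z v ⌉ᵠ
        a w = c w ℚ.- (z w ℚ.+ z w)
        b u = (z u ℚ.+ z u) ℚ.- c u

        z≡x⁰ : ∀ {u} → U u → z u ≡ x⁰ u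
        z≡x⁰ Uu = x-fixed _ (U∧W⇒⊥ Uu)

        -- Both cases are closed by evaluation: the loss is 0 at 0 and -1 at 1.
        a≤0 : ∀ w → W w → z w ≡ 0ℚ ⊎ z w ≡ 1ℚ → a w ℚ.≤ 0ℚ
        a≤0 w _ (inj₁ eq) = subst (λ q → ⌈ q ⌉ᵠ ℚ.- (q ℚ.+ q) ℚ.≤ 0ℚ) (sym eq) (ℚ.≤ᵇ⇒≤ tt)
        a≤0 w _ (inj₂ eq) = subst (λ q → ⌈ q ⌉ᵠ ℚ.- (q ℚ.+ q) ℚ.≤ 0ℚ) (sym eq) (ℚ.≤ᵇ⇒≤ tt)

        -- `M` depends on the state only through `T`, so extremality for the LP4 of `s` combines
        -- with the invariant and calmness at `z`, where `T` is unchanged.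
        ∑a≤∑b : ∑∈ W? a ℚ.≤ ∑∈ U? b
        ∑a≤∑b = ∑W≤∑U s opt a b
          (λ u Uu → 0≤-diff (⌈⌉≤double (subst (½ ℚ.≤_) (sym (z≡x⁰ Uu)) Uu)))
          (λ u w Uu Ww M≢0 → subst (λ q → a w ℚ.≤ (q ℚ.+ q) ℚ.- ⌈ q ⌉ᵠ) (sym (z≡x⁰ Uu))
            (charge (state z y (State.T s)) inv calm u w Uu Ww M≢0))
          a≤0

        aW bU : V → ℚ
        aW w = if does (W? w) then a w else 0ℚ
        bU u = if does (U? u) then b u else 0ℚ

        balance : ∀ v → c v ℚ.+ bU v ≡ (z v ℚ.+ z v) ℚ.+ aW v
        balance v with kind v
        ... | inU Uv = trans (cong (c v ℚ.+_) (if-yes (U? v) Uv))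
          (trans (solve 2 (λ c z → c :+ ((z :+ z) :- c) := (z :+ z) :+ con 0ℚ) refl (c v) (z v))
                 (cong ((z v ℚ.+ z v) ℚ.+_) (sym (if-no (W? v) (U∧W⇒⊥ Uv)))))
        ... | inW Wv = trans (cong (c v ℚ.+_) (if-no (U? v) λ Uv → U∧W⇒⊥ Uv Wv))
          (trans (solve 2 (λ c z → c :+ con 0ℚ := (z :+ z) :+ (c :- (z :+ z))) refl (c v) (z v))
                 (cong ((z v ℚ.+ z v) ℚ.+_) (sym (if-yes (W? v) Wv))))
        ... | isZero x⁰≡0 = trans (cong (c v ℚ.+_) (if-no (U? v) (zero⇒¬U x⁰≡0)))
          -- The equation is moved to the value 0, where both sides agree by evaluation, and back.
          (trans (cong (λ q → ⌈ q ⌉ᵠ ℚ.+ 0ℚ) z≡0)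
          (trans (cong (λ q → (q ℚ.+ q) ℚ.+ 0ℚ) (sym z≡0))
                 (cong ((z v ℚ.+ z v) ℚ.+_) (sym (if-no (W? v) (zero⇒¬W x⁰≡0))))))
          where
          z≡0 : z v ≡ 0ℚ
          z≡0 = trans (x-fixed v (zero⇒¬W x⁰≡0)) x⁰≡0

      ∑⌈z⌉≤2∑z : sumℚ (λ v → ⌈ z v ⌉ᵠ) ℚ.≤ sumℚ z ℚ.+ sumℚ z
      ∑⌈z⌉≤2∑z = ≤-by (sumℚ bU ℚ.- sumℚ aW) (0≤-diff ∑a≤∑b) (begin
        sumℚ c ℚ.+ (sumℚ bU ℚ.- sumℚ aW)                       ≡⟨ ℚ.+-assoc (sumℚ c) (sumℚ bU) (ℚ.- sumℚ aW) ⟨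
        sumℚ c ℚ.+ sumℚ bU ℚ.- sumℚ aW                         ≡⟨ cong (ℚ._- sumℚ aW) (∑-distrib-+ c bU) ⟨
        sumℚ (λ v → c v ℚ.+ bU v) ℚ.- sumℚ aW                  ≡⟨ cong (ℚ._- sumℚ aW) (sum-cong-≗ balance) ⟩
        sumℚ (λ v → (z v ℚ.+ z v) ℚ.+ aW v) ℚ.- sumℚ aW        ≡⟨ cong (ℚ._- sumℚ aW) (∑-distrib-+ (λ v → z v ℚ.+ z v) aW) ⟩
        sumℚ (λ v → z v ℚ.+ z v) ℚ.+ sumℚ aW ℚ.- sumℚ aW       ≡⟨ solve 2 (λ p q → p :+ q :- q := p) refl (sumℚ (λ v → z v ℚ.+ z v)) (sumℚ aW) ⟩
        sumℚ (λ v → z v ℚ.+ z v)                               ≡⟨ ∑-distrib-+ z z ⟩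
        sumℚ z ℚ.+ sumℚ z                                      ∎)
        where open ≡-Reasoning

    -- Complete runs of the algorithm

    RoundingCost : State → Set
    RoundingCost s = sumℚ (λ v → ⌈ State.x s v ⌉ᵠ) ℚ.≤ sumℚ (State.x s) ℚ.+ sumℚ (State.x s)

    -- Induction on the run. The cost bound arises at `finish`, where `t = 1` makes the final point
    -- the extreme point itself.
    steps-output : ∀ {s s′} → Steps3-6 s s′ → Invariant s → Calm s → Invariant s′ × RoundingCost s′
    steps-output {s} (stop xnew t e u target 0≤t t≤1 (w , mv@(_ , joins , Uu , _) , hit) no-hit steps) inv calm =
      steps-output steps
        (addVia-invariant e u Uu (joins⇒∈ joins)
          (subst (λ β → 1ℚ ℚ.≤ yᵗ s xnew t e u ℚ.* β) (boost-fixed (State.x s) (Invariant.x-fixed inv u (U∧W⇒⊥ Uu)))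
            (ℚ.≤-reflexive (sym hit)))
          (advance-invariant s inv xnew target t 0≤t t≤1))
        (λ e′ u′ w′ mv′ → advance-calm s inv xnew target calm t 0≤t no-hit e′ u′ w′ (addVia-moving e u (State.T s) mv′))
    steps-output {s} (finish xnew target no-hit) inv calm = inv′ , subst₂ ℚ._≤_
        (sum-cong-≗ λ v → cong ⌈_⌉ᵠ (sym (x¹≡ v))) (cong₂ ℚ._+_ (sum-cong-≗ λ v → sym (x¹≡ v)) (sum-cong-≗ λ v → sym (x¹≡ v)))
        (∑⌈z⌉≤2∑z (LP4.Target.optimal target) (yᵗ s xnew 1ℚ) inv″
          (advance-calm s inv xnew target calm 1ℚ 0≤1 λ t e u 0≤t t<1 → no-hit t e u 0≤t (ℚ.<⇒≤ t<1)))
      where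
      inv′ = advance-invariant s inv xnew target 1ℚ 0≤1 ℚ.≤-refl
      x¹≡ : ∀ v → xᵗ s xnew 1ℚ v ≡ xnew v
      x¹≡ v = solve 2 (λ p q → (con 1ℚ :- con 1ℚ) :* p :+ con 1ℚ :* q := q) refl (State.x s v) (xnew v)
      -- At `t = 1` the vector `xᵗ` agrees with `xnew` pointwise but is not the same function, so
      -- the fields that mention `x` are transported one by one.
      inv″ : Invariant (state xnew (yᵗ s xnew 1ℚ) (State.T s))
      inv″ = record
        { Invariant inv′
        ; x-fixed = λ v ¬Wv → trans (sym (x¹≡ v)) (Invariant.x-fixed inv′ v ¬Wv)
        ; x≥0     = λ w Ww → subst (0ℚ ℚ.≤_) (x¹≡ w) (Invariant.x≥0 inv′ w Ww)
        ; x≤1     = λ w Ww → subst (ℚ._≤ 1ℚ) (x¹≡ w) (Invariant.x≤1 inv′ w Ww)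
        ; y-ratio = λ e u w mv → trans (Invariant.y-ratio inv′ e u w mv) (cong (ratio e w ℚ.*_) (x¹≡ w))
        ; ∑x≤∑x⁰  = subst (ℚ._≤ sumℚ x⁰) (sum-cong-≗ x¹≡) (Invariant.∑x≤∑x⁰ inv′)
        }

    step2-output : ∀ {s s′} → Star _⟶_ s s′ → Invariant s → Invariant s′
    step2-output done           inv = inv
    step2-output (step ◅ steps) inv = step2-output steps (step2-invariant step inv)

    -- Feasibility of the rounded solution

    module _ (s : State) (inv : Invariant s) where
      open State s
      open Invariant inv

      x-nonneg : ∀ v → 0ℚ ℚ.≤ x v
      x-nonneg v with W? v
      ... | yes Wv = x≥0 v Wv
      ... | no ¬Wv = subst (0ℚ ℚ.≤_) (sym (x-fixed v ¬Wv)) (LP1-sol.x≥0 v)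

      -- On `W` the bound `x w ≤ 1` is enough, because `0 < x⁰ w ≤ m w` forces the integer `m w` to
      -- be at least 1.
      x-bounded : ∀ v → x v ℚ.≤ fromℤ (+ m v)
      x-bounded v with W? v
      ... | yes Wv = ℚ.≤-trans (x≤1 v Wv) (fromℤ-mono-≤ {1ℤ} (ℤ.i<j⇒suc[i]≤j {0ℤ} {+ m v} (ℤ.≰⇒> λ m≤0 →
        ℚ.<-irrefl refl (ℚ.<-≤-trans (proj₁ Wv) (ℚ.≤-trans (LP1-sol.x≤m v) (fromℤ-mono-≤ m≤0))))))
      ... | no ¬Wv = subst (ℚ._≤ fromℤ (+ m v)) (sym (x-fixed v ¬Wv)) (LP1-sol.x≤m v)

      x̄≥0 : ∀ v → 0ℤ ℤ.≤ x̄ s v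
      x̄≥0 v = fromℤ-cancel-≤ (ℚ.≤-trans (x-nonneg v) (p≤⌈p⌉ (x v)))

      ȳ-assigned : ∀ e → ȳ s e (end₁ e) ℚ.+ ȳ s e (end₂ e) ≡ 1ℚ
      ȳ-assigned e with T e in eq
      ... | nothing = y-assigned e
      ... | just u with proj₁ (proj₂ (via e u eq))
      ...   | inj₁ refl = cong₂ ℚ._+_ (if-yes (end₁ e Fin.≟ end₁ e) refl) (if-no (end₂ e Fin.≟ end₁ e) (loopless e ∘ sym))
      ...   | inj₂ refl = cong₂ ℚ._+_ (if-no (end₁ e Fin.≟ end₂ e) (loopless e)) (if-yes (end₂ e Fin.≟ end₂ e) refl)

      ȳ≥0 : ∀ e v → v ∈ₑ e → 0ℚ ℚ.≤ ȳ s e v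
      ȳ≥0 e v v∈e with T e
      ... | nothing = y≥0 e v v∈e
      ... | just u  = if-elim (0ℚ ℚ.≤_) (v Fin.≟ u) (λ _ → 0≤1) (λ _ → ℚ.≤-refl)

      -- One factor covers all edges at `u`, whether in `T` or not. Scaling the load bound
      -- `k u * x⁰ u` by it gives exactly the rounded capacity `k u * ⌈ x⁰ u ⌉`.
      ȳ≤boosted : ∀ e u → u ∈ₑ e → U u → ȳ s e u ℚ.≤ boost x⁰ u ℚ.* y e u
      ȳ≤boosted e u u∈e Uu with T e in eq
      ... | nothing = subst (ℚ._≤ boost x⁰ u ℚ.* y e u) (ℚ.*-identityˡ (y e u)) (*-monoʳ (y≥0 e u u∈e) (1≤boost Uu))
      ... | just u′ = if-elim (ℚ._≤ boost x⁰ u ℚ.* y e u) (u Fin.≟ u′)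
        (λ { refl → subst (1ℚ ℚ.≤_) (ℚ.*-comm (y e u) (boost x⁰ u)) (proj₂ (proj₂ (via e u eq))) })
        (λ _ → 0≤* (boost≥0 Uu) (y≥0 e u u∈e))

      -- An edge in `T` was added via a vertex of `U`, hence not via `w`, and puts nothing on `w`.
      -- Outside `T` it still moves, since its other endpoint lies in `U`, and so follows the ratio.
      ȳ≤ratio : ∀ e w → w ∈ₑ e → W w → ȳ s e w ℚ.≤ x w ℚ.* ratio e w
      ȳ≤ratio e w w∈e Ww with T e in eq
      ... | nothing = ℚ.≤-reflexive (trans
        (y-ratio e (opposite e w) w (eq , opposite-joins w∈e , W-opposite-U (opposite-joins w∈e) Ww , Ww))
        (ℚ.*-comm (ratio e w) (x w)))
      ... | just u  = if-elim (ℚ._≤ x w ℚ.* ratio e w) (w Fin.≟ u)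
        (λ { refl → ⊥-elim (U∧W⇒⊥ (proj₁ (via e w eq)) Ww) })
        (λ _ → 0≤* (x≥0 w Ww) (ratio≥0 w∈e Ww))

      ȳ-zero : ∀ e v → v ∈ₑ e → x⁰ v ≡ 0ℚ → ȳ s e v ≡ 0ℚ
      ȳ-zero e v v∈e x⁰≡0 with T e in eq
      ... | nothing = y-zero e v v∈e x⁰≡0
      ... | just u  = if-no (v Fin.≟ u) λ { refl → zero⇒¬U x⁰≡0 (proj₁ (via e v eq)) }

      ȳ-capacity : ∀ v → ∑∈ (v ∈ₑ?_) (λ e → ȳ s e v) ℚ.≤ fromℤ (+ k v ℤ.* x̄ s v)
      ȳ-capacity v = subst (∑∈ (v ∈ₑ?_) (λ e → ȳ s e v) ℚ.≤_) (sym (fromℤ-* (+ k v) (x̄ s v))) (by-kind (kind v))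
        where
        open ℚ.≤-Reasoning
        κ = fromℤ (+ k v)
        0≤κ : 0ℚ ℚ.≤ κ
        0≤κ = 0≤fromℕ (k v)
        by-kind : Kind v → ∑∈ (v ∈ₑ?_) (λ e → ȳ s e v) ℚ.≤ κ ℚ.* ⌈ x v ⌉ᵠ
        by-kind (inU Uv) = begin
          ∑∈ (v ∈ₑ?_) (λ e → ȳ s e v)                  ≤⟨ ∑∈-mono (v ∈ₑ?_) (λ e v∈e → ȳ≤boosted e v v∈e Uv) ⟩
          ∑∈ (v ∈ₑ?_) (λ e → boost x⁰ v ℚ.* y e v)     ≡⟨ ∑∈-* (v ∈ₑ?_) (boost x⁰ v) (λ e → y e v) ⟩
          boost x⁰ v ℚ.* ∑∈ (v ∈ₑ?_) (λ e → y e v)     ≤⟨ *-monoˡ (boost≥0 Uv) (U-load v Uv) ⟩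
          boost x⁰ v ℚ.* (κ ℚ.* x⁰ v)                  ≡⟨ solve 3 (λ b k x → b :* (k :* x) := k :* (b :* x)) refl (boost x⁰ v) κ (x⁰ v) ⟩
          κ ℚ.* (boost x⁰ v ℚ.* x⁰ v)                  ≡⟨ cong (κ ℚ.*_) (boost-* Uv) ⟩
          κ ℚ.* ⌈ x⁰ v ⌉ᵠ                              ≡⟨ cong (λ q → κ ℚ.* ⌈ q ⌉ᵠ) (x-fixed v (U∧W⇒⊥ Uv)) ⟨
          κ ℚ.* ⌈ x v ⌉ᵠ                               ∎
        by-kind (inW Wv) = begin
          ∑∈ (v ∈ₑ?_) (λ e → ȳ s e v)                  ≤⟨ ∑∈-mono (v ∈ₑ?_) (λ e v∈e → ȳ≤ratio e v v∈e Wv) ⟩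
          ∑∈ (v ∈ₑ?_) (λ e → x v ℚ.* ratio e v)        ≡⟨ ∑∈-* (v ∈ₑ?_) (x v) (λ e → ratio e v) ⟩
          x v ℚ.* R                                    ≤⟨ *-monoˡ (x≥0 v Wv) R≤κ ⟩
          x v ℚ.* κ                                    ≤⟨ *-monoʳ 0≤κ (p≤⌈p⌉ (x v)) ⟩
          ⌈ x v ⌉ᵠ ℚ.* κ                               ≡⟨ ℚ.*-comm ⌈ x v ⌉ᵠ κ ⟩
          κ ℚ.* ⌈ x v ⌉ᵠ                               ∎
          where
          R = ∑∈ (v ∈ₑ?_) (λ e → ratio e v)
          -- This is the LP1 capacity constraint of `v` divided by `x⁰ v`; it bounds the load by
          -- `κ * x v` for every later value of `x v`.
          R≤κ : R ℚ.≤ κ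
          R≤κ = *-cancelʳ (proj₁ Wv) (begin
            R ℚ.* x⁰ v                                 ≡⟨ ℚ.*-comm R (x⁰ v) ⟩
            x⁰ v ℚ.* R                                 ≡⟨ ∑∈-* (v ∈ₑ?_) (x⁰ v) (λ e → ratio e v) ⟨
            ∑∈ (v ∈ₑ?_) (λ e → x⁰ v ℚ.* ratio e v)     ≡⟨ ∑∈-cong (v ∈ₑ?_) (λ e _ → trans (ℚ.*-comm (x⁰ v) (ratio e v)) (ratio-* e Wv)) ⟩
            ∑∈ (v ∈ₑ?_) (λ e → y⁰ e v)                 ≤⟨ LP1-sol.capacity v ⟩
            κ ℚ.* x⁰ v                                 ∎)
        by-kind (isZero x⁰≡0) = begin
          ∑∈ (v ∈ₑ?_) (λ e → ȳ s e v)                  ≡⟨ sum-zero (λ e → if-elim (_≡ 0ℚ) (v ∈ₑ? e) (λ v∈e → ȳ-zero e v v∈e x⁰≡0) (λ _ → refl)) ⟩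
          0ℚ                                           ≤⟨ 0≤* 0≤κ (ℚ.≤-trans (x-nonneg v) (p≤⌈p⌉ (x v))) ⟩
          κ ℚ.* ⌈ x v ⌉ᵠ                               ∎

      rounded-feasible : ∃[ y′ ] VCHC.Feasible I (x̄ s) y′
      rounded-feasible = integral-assignment I (x̄ s) (ȳ s) x̄≥0 (λ v → ceiling-least (x-bounded v))
        ȳ-assigned ȳ≥0 ȳ-capacity

-- LP1 as a relaxation of VCHC

relaxation : ∀ (I : Instance) {x y} → VCHC.Feasible I x y →
             LP1.Feasible I (λ v → fromℤ (x v)) (λ e v → fromℤ (+ toℕ (y e v)))
relaxation I {x} {y} feasible = record
  { assigned = λ e → trans (sym (fromℤ-+ (+ toℕ (y e (end₁ e))) (+ toℕ (y e (end₂ e))))) (cong (fromℤ ∘ +_) (assigned e))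
  ; y≤x      = λ e v v∈e → fromℤ-mono-≤ (y≤x e v v∈e)
  ; capacity = λ v → subst₂ ℚ._≤_ (load-eq v) (fromℤ-* (+ k v) (x v)) (fromℤ-mono-≤ (capacity v))
  ; x≤m      = λ v → fromℤ-mono-≤ (x≤m v)
  ; x≥0      = λ v → fromℤ-mono-≤ (x≥0 v)
  ; y≥0      = λ e v _ → 0≤fromℕ (toℕ (y e v))
  }
  where
  open Instance I
  open VCHC.Feasible feasible

  at? : ∀ v e → Dec (v ∈ₑ e × y e v ≡ 1F)
  at? v e = (v ∈ₑ? e) ×-dec (y e v Fin.≟ 1F)

  indicator-at : ∀ v e → fromℤ (indicator (does (at? v e))) ≡ (if does (v ∈ₑ? e) then fromℤ (+ toℕ (y e v)) else 0ℚ)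
  indicator-at v e = go (v ∈ₑ? e) (y e v)
    where
    go : ∀ (d : Dec (v ∈ₑ e)) (i : Fin 2) → fromℤ (indicator (does (d ×-dec (i Fin.≟ 1F)))) ≡ (if does d then fromℤ (+ toℕ i) else 0ℚ)
    go (no _)  i  = refl
    go (yes _) 0F = refl
    go (yes _) 1F = refl

  load-eq : ∀ v → fromℤ (+ length (filter (at? v) (allFin #E))) ≡ ∑∈ (v ∈ₑ?_) (λ e → fromℤ (+ toℕ (y e v)))
  load-eq v = trans (cong fromℤ (length-filter (at? v) id))
    (trans (fromℤ-sum (λ e → indicator (does (at? v e)))) (sum-cong-≗ (indicator-at v)))

  -- k v * x v ≥ y e v = 1 forces x v ≥ 1.
  y≤x : ∀ e v → v ∈ₑ e → + toℕ (y e v) ℤ.≤ x v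
  y≤x e v v∈e with y e v in eq
  ... | 0F = x≥0 v
  ... | 1F = ℤ.i<j⇒suc[i]≤j (ℤ.≤∧≢⇒< (x≥0 v) λ 0≡x → 1≰0 (subst (λ q → 1ℤ ℤ.≤ + k v ℤ.* q) (sym 0≡x)
      (ℤ.≤-trans 1≤load (capacity v))))
    where
    1≰0 : ¬ 1ℤ ℤ.≤ + k v ℤ.* 0ℤ
    1≰0 1≤ with subst (1ℤ ℤ.≤_) (ℤ.*-zeroʳ (+ k v)) 1≤
    ... | ℤ.+≤+ ()
    1≤load : 1ℤ ℤ.≤ + length (filter (at? v) (allFin #E))
    1≤load = fromℤ-cancel-≤ (begin
      1ℚ                                                                     ≡⟨ cong (λ i → fromℤ (+ toℕ i)) eq ⟨
      fromℤ (+ toℕ (y e v))                                                  ≡⟨ if-yes (v ∈ₑ? e) v∈e ⟨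
      (if does (v ∈ₑ? e) then fromℤ (+ toℕ (y e v)) else 0ℚ)                 ≤⟨ term≤sum (λ e → if-elim (0ℚ ℚ.≤_) (v ∈ₑ? e) (λ _ → 0≤fromℕ (toℕ (y e v))) (λ _ → ℚ.≤-refl)) e ⟩
      ∑∈ (v ∈ₑ?_) (λ e → fromℤ (+ toℕ (y e v)))                              ≡⟨ load-eq v ⟨
      fromℤ (+ length (filter (at? v) (allFin #E)))                          ∎)
      where open ℚ.≤-Reasoning

theorem16 : ∀ (I : Instance) → (∃[ x ] ∃[ y ] LP1.Feasible I x y) →
    ∀ x̄ ȳ → Output I x̄ ȳ →
    (∃[ y′ ] VCHC.Feasible I x̄ y′) ×
    (∀ opt → VCHC.IsOPT I opt → VCHC.cost I x̄ ≤ + 2 * opt)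
theorem16 I _ _ _ (output x⁰ y⁰ optimal s s′ (step2 , stuck) steps) =
  rounded-feasible s′ (proj₁ final) , cost≤
  where
  open LP1.Optimal optimal
  open Rounding I x⁰ y⁰
  open Analysis I x⁰ y⁰ feasible
  inv : Invariant s
  inv = step2-output step2 initial-invariant
  final : Invariant s′ × RoundingCost s′
  final = steps-output steps inv (step2-calm inv stuck)
  cost≤ : ∀ opt → VCHC.IsOPT I opt → VCHC.cost I (x̄ s′) ℤ.≤ + 2 ℤ.* opt
  cost≤ opt isOPT with VCHC.IsOPT.attained isOPT
  ... | x , y , x-feasible , cost≡opt = fromℤ-cancel-≤ (begin
    fromℤ (sumℤ (x̄ s′))                                ≡⟨ fromℤ-sum (x̄ s′) ⟩
    sumℚ (λ v → fromℤ (x̄ s′ v))                        ≤⟨ proj₂ final ⟩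
    sumℚ (State.x s′) ℚ.+ sumℚ (State.x s′)            ≤⟨ ℚ.+-mono-≤ ∑x≤opt ∑x≤opt ⟩
    fromℤ opt ℚ.+ fromℤ opt                            ≡⟨ fromℤ-+ opt opt ⟨
    fromℤ (opt ℤ.+ opt)                                ≡⟨ cong fromℤ (double opt) ⟩
    fromℤ (+ 2 ℤ.* opt)                                ∎)
    where
    open ℚ.≤-Reasoning
    double : ∀ i → i ℤ.+ i ≡ + 2 ℤ.* i
    double i = sym (trans (ℤ.*-distribʳ-+ i 1ℤ 1ℤ) (cong₂ ℤ._+_ (ℤ.*-identityˡ i) (ℤ.*-identityˡ i)))
    ∑x≤opt : sumℚ (State.x s′) ℚ.≤ fromℤ opt
    ∑x≤opt = begin
      sumℚ (State.x s′)             ≤⟨ Invariant.∑x≤∑x⁰ (proj₁ final) ⟩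
      sumℚ x⁰                       ≤⟨ minimal _ _ (relaxation I x-feasible) ⟩
      sumℚ (λ v → fromℤ (x v))      ≡⟨ fromℤ-sum x ⟨
      fromℤ (sumℤ x)                ≡⟨ cong fromℤ cost≡opt ⟩
      fromℤ opt                     ∎
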